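{- Let $n>1$ be finite and let $\mathcal L_n$ be the logic corresponding to $\mathsf D_n$ or to $\mathsf G_n$. Then $\mathcal L_n$ has the omitting types theorem. In fact, if $T$ is a countable consistent $\mathcal L_n$ theory, then any family of fewer than $\mathrm{cov}K$ many non-principal types of $T$ can be omitted in a model of $T$ (of type $\mathsf D_n$, respectively $\mathsf G_n$) with countable base.
   Context: $\mathrm{cov}K$ is the least cardinal $\kappa$ such that the real line can be covered by $\kappa$ nowhere dense sets. $\mathsf D_n$ is the class of relativized set algebras with unit a set $V\subseteq{}^nM$ such that $s\in V$ implies $s\circ[i|j]\in V$ for all $i,j<n$ ($[i|j]$ sends $i$ to $j$ and fixes everything else); $\mathsf G_n$ is the class of those with unit $V$ such that $s\in V$ implies $s\circ\tau\in V$ for all $\tau:n\to n$. In such algebras $c_iX=\{s\in V:\exists t\in X,\ t_j=s_j\ \forall j\ne i\}$, $d_{ij}=\{s\in V:s_i=s_j\}$ (and for $\mathsf G_n$ also $s_\tau X=\{s\in V:s\circ\tau\in X\}$). The corresponding logic $\mathcal L_n$: formulas are built from $n$-ary relation symbols $R(x_0,\dots,x_{n-1})$ (for $\mathsf G_n$ also $R(x_{\tau(0)},\dots,x_{\tau(n-1)})$, $\tau:n\to n$) and equalities $x_i=x_j$ ($i,j<n$) by Boolean connectives and quantifiers $\exists x_i$, $i<n$. A model consists of a base $M$, a set $V\subseteq{}^nM$ that is a unit of the kind required for $\mathsf D_n$ (respectively $\mathsf G_n$) with $M=\bigcup_{s\in V}\mathrm{rng}(s)$, and an interpretation of each relation symbol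 as a subset of $V$. Satisfaction is defined only for $s\in V$ as usual, with quantifiers relativized to $V$: $s$ satisfies $\exists x_i\phi$ iff some $t\in V$ with $t_j=s_j$ for $j\ne i$ satisfies $\phi$; and $s$ satisfies $R(x_{\tau(0)},\dots,x_{\tau(n-1)})$ iff $s\circ\tau$ is in the interpretation of $R$. It is a model of $T$ if every $s\in V$ satisfies every formula of $T$. $T\models\phi$ means every model of $T$ has all $s\in V$ satisfying $\phi$; a formula $\psi$ is consistent with $T$ if not $T\models\neg\psi$. A type $\Gamma$ (set of formulas) is non-principal if there is no $\psi$ consistent with $T$ with $T\models\psi\to\gamma$ for all $\gamma\in\Gamma$. It is omitted in a model if no $s\in V$ satisfies all of $\Gamma$. $\mathcal L_n$ has the omitting types theorem if, for countable consistent $T$, any countable family of non-principal types can be omitted in a model of $T$. -}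

module Defs where

open import Data.Empty using (⊥)
open import Data.Fin using (Fin)
open import Data.Nat using (ℕ)
open import Data.Product using (Σ-syntax; ∃-syntax; _×_)
open import Data.Rational using (ℚ; _<_)
open import Data.Sum using (_⊎_)
open import Data.Vec using (Vec; map; lookup; allFin; _[_]≔_)
open import Data.Vec.Membership.Propositional using () renaming (_∈_ to _occursIn_)
open import Function.Bundles using (_↣_)
open import Level using (Level; 0ℓ; suc; _⊔_)
open import Relation.Binary.Definitions using (_Respects_)
open import Relation.Binary.PropositionalEquality using (_≡_; _≢_)
open import Relation.Nullary using (¬_)
open import Relation.Unary using (Pred; _∈_; _∉_; _⊆_; _≐_; Empty; Satisfiable)

------------------------------------------------------------------------
-- The real line and cov K

-- A real number is a (lower) Dedekind cut in ℚ.
record ℝ : Set₁ where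
  field
    Lower     : Pred ℚ 0ℓ
    inhabited : ∃[ q ] q ∈ Lower
    proper    : ∃[ q ] q ∉ Lower
    downward  : ∀ {p q} → p < q → q ∈ Lower → p ∈ Lower
    no-max    : ∀ {p} → p ∈ Lower → ∃[ q ] p < q × q ∈ Lower

open ℝ public

infix 4 _≈_

_≈_ : ℝ → ℝ → Set
x ≈ y = Lower x ≐ Lower y

-- The open interval with rational endpoints: p ∈ Lower x says p < x, and
-- x < q says that some rational below q is not in Lower x.  These
-- intervals are the base of the topology used below.
⦅_,_⦆ : ℚ → ℚ → Pred ℝ 0ℓ
⦅ p , q ⦆ x = p ∈ Lower x × (∃[ r ] r < q × r ∉ Lower x)

Closure : ∀ {ℓ} → Pred ℝ ℓ → Pred ℝ (suc 0ℓ ⊔ ℓ)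
Closure A x = ∀ p q → x ∈ ⦅ p , q ⦆ → ∃[ y ] y ∈ ⦅ p , q ⦆ × y ∈ A

Interior : ∀ {ℓ} → Pred ℝ ℓ → Pred ℝ (suc 0ℓ ⊔ ℓ)
Interior A x = ∃[ p ] ∃[ q ] x ∈ ⦅ p , q ⦆ × ⦅ p , q ⦆ ⊆ A

NowhereDense : ∀ {ℓ} → Pred ℝ ℓ → Set (suc 0ℓ ⊔ ℓ)
NowhereDense A = Empty (Interior (Closure A))

-- Cardinals are represented by types, compared by injections.  ℝ carries
-- the equality _≈_, so only predicates respecting it count as subsets.
CoversLine : Set → Set₁
CoversLine K =
  Σ[ A ∈ (K → Pred ℝ 0ℓ) ]
    (∀ k → A k Respects _≈_) ×
    (∀ k → NowhereDense (A k)) ×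
    (∀ x → ∃[ k ] x ∈ A k)

-- K has cardinality cov K.
IsCovK : Set → Set₁
IsCovK K = CoversLine K × (∀ (K′ : Set) → CoversLine K′ → K ↣ K′)

infix 4 _≺_

_≺_ : Set → Set → Set
A ≺ B = (A ↣ B) × ¬ (B ↣ A)

-- Finite or countably infinite.
Countable : Set → Set
Countable A = A ↣ ℕ

------------------------------------------------------------------------
-- Units

data Kind : Set where
  D G : Kind

-- s ∘ τ for s ∈ ⁿM and τ : n → n, both given as vectors of values.
infixl 9 _∘ᵥ_

_∘ᵥ_ : ∀ {M : Set} {n} → Vec M n → Vec (Fin n) n → Vec M n
s ∘ᵥ τ = map (lookup s) τ

[_∣_] : ∀ {n} → Fin n → Fin n → Vec (Fin n) n
[_∣_] {n} i j = allFin n [ i ]≔ j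

IsUnit : Kind → ∀ {M : Set} {n} → Pred (Vec M n) 0ℓ → Set
IsUnit D {n = n} V = ∀ s → s ∈ V → ∀ (i j : Fin n) → s ∘ᵥ [ i ∣ j ] ∈ V
IsUnit G {n = n} V = ∀ s → s ∈ V → ∀ (τ : Vec (Fin n) n) → s ∘ᵥ τ ∈ V

------------------------------------------------------------------------
-- The logic corresponding to D n or G n, over a set R of n-ary relation
-- symbols

infixr 7 _∧′_
infixr 6 _∨′_
infixr 5 _⇒′_

data Formula (R : Set) (n : ℕ) : Kind → Set where
  rel    : ∀ {k} → R → Formula R n k
  relAt  : R → Vec (Fin n) n → Formula R n G   -- r (x_τ(0) , … , x_τ(n-1))
  eq     : ∀ {k} → Fin n → Fin n → Formula R n k
  ⊥′     : ∀ {k} → Formula R n k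
  _∧′_   : ∀ {k} → Formula R n k → Formula R n k → Formula R n k
  _∨′_   : ∀ {k} → Formula R n k → Formula R n k → Formula R n k
  _⇒′_   : ∀ {k} → Formula R n k → Formula R n k → Formula R n k
  ∃′     : ∀ {k} → Fin n → Formula R n k → Formula R n k

¬′_ : ∀ {R n k} → Formula R n k → Formula R n k
¬′ φ = φ ⇒′ ⊥′

-- The unit is required to be nonempty: with an empty unit every theory
-- would hold and every type would be omitted.
record Model (R : Set) (n : ℕ) (k : Kind) : Set₁ where
  field
    Base     : Set
    V        : Pred (Vec Base n) 0ℓ
    isUnit   : IsUnit k V
    nonempty : Satisfiable V
    covers   : ∀ m → ∃[ s ] s ∈ V × m occursIn s
    ⟦_⟧      : R → Pred (Vec Base n) 0ℓ
    ⟦⟧⊆V     : ∀ r → ⟦ r ⟧ ⊆ V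

module _ {R : Set} {n : ℕ} {k : Kind} where

  -- Meaningful for s ∈ V only; all uses below are restricted to such s.
  Sat : (𝔐 : Model R n k) → Vec (Model.Base 𝔐) n → Formula R n k → Set
  Sat 𝔐 s (rel r)     = s ∈ Model.⟦_⟧ 𝔐 r
  Sat 𝔐 s (relAt r τ) = s ∘ᵥ τ ∈ Model.⟦_⟧ 𝔐 r
  Sat 𝔐 s (eq i j)    = lookup s i ≡ lookup s j
  Sat 𝔐 s ⊥′          = ⊥
  Sat 𝔐 s (φ ∧′ ψ)    = Sat 𝔐 s φ × Sat 𝔐 s ψ
  Sat 𝔐 s (φ ∨′ ψ)    = Sat 𝔐 s φ ⊎ Sat 𝔐 s ψ
  Sat 𝔐 s (φ ⇒′ ψ)    = Sat 𝔐 s φ → Sat 𝔐 s ψ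
  Sat 𝔐 s (∃′ i φ)    =
    ∃[ t ] t ∈ Model.V 𝔐 × (∀ j → j ≢ i → lookup t j ≡ lookup s j) × Sat 𝔐 t φ

  Valid : Model R n k → Formula R n k → Set
  Valid 𝔐 φ = ∀ s → s ∈ Model.V 𝔐 → Sat 𝔐 s φ

  IsModelOf : Model R n k → Pred (Formula R n k) 0ℓ → Set
  IsModelOf 𝔐 T = ∀ φ → φ ∈ T → Valid 𝔐 φ

  infix 4 _⊨_

  _⊨_ : Pred (Formula R n k) 0ℓ → Formula R n k → Set₁
  T ⊨ φ = ∀ 𝔐 → IsModelOf 𝔐 T → Valid 𝔐 φ

  Consistent : Pred (Formula R n k) 0ℓ → Set₁
  Consistent T = ¬ (T ⊨ ⊥′)

  ConsistentWith : Pred (Formula R n k) 0ℓ → Formula R n k → Set₁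
  ConsistentWith T ψ = ¬ (T ⊨ ¬′ ψ)

  NonPrincipal : Pred (Formula R n k) 0ℓ → Pred (Formula R n k) 0ℓ → Set₁
  NonPrincipal T Γ =
    ¬ (∃[ ψ ] ConsistentWith T ψ × (∀ γ → γ ∈ Γ → T ⊨ ψ ⇒′ γ))

  Omits : Model R n k → Pred (Formula R n k) 0ℓ → Set
  Omits 𝔐 Γ = ¬ (∃[ s ] s ∈ Model.V 𝔐 × (∀ γ → γ ∈ Γ → Sat 𝔐 s γ))

-- A countable theory is a theory in a countable language, i.e. over a
-- countable set of relation symbols.
HasOmittingTypesTheorem : ℕ → Kind → Set₁
HasOmittingTypesTheorem n k =
  (R : Set) → Countable R →
  (T : Pred (Formula R n k) 0ℓ) → Consistent T →
  (I : Set) → Countable I →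
  (Γ : I → Pred (Formula R n k) 0ℓ) → (∀ i → NonPrincipal T (Γ i)) →
  Σ[ 𝔐 ∈ Model R n k ] IsModelOf 𝔐 T × (∀ i → Omits 𝔐 (Γ i))

{-# OPTIONS --safe #-}
module Submission where

-- A tree of tuples has a root and, below each of its tuples s, for every i and
-- ψ a tuple that differs from s at most at i and satisfies ψ if s satisfies
-- ∃xᵢψ (for G also the transposed tuples).  Finitely many demands on such a
-- tree are expressed by one formula at any chosen node of it, because an edge
-- of the tree can be followed by a quantifier (or a transposition) in both
-- directions.  So a non-principal type can be refuted at any given node by one
-- further demand, and a generic sequence of demands omits the types everywhere.
-- Its model has for elements the coordinates of the nodes, identified when
-- finitely many of the demands force them to be equal.
--
-- A type gives infinitely many dense sets of demands, so fewer than cov K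
-- types I require meeting dense sets indexed by I × ℕ.  Excluded middle for all
-- types yields choice functions, but not ones that respect extensional
-- equality, so an injection of I × ℕ into I is not at hand.  Instead, as in the
-- arguments of Miller and Bartoszyński, if nowhere dense sets indexed by I
-- never cover the line, then any functions on ℕ indexed by I are met by a
-- single function, first at one place and then infinitely often, and the
-- generic sequence is obtained by guessing its steps in this way.

open import Defs
open import Axiom.ExcludedMiddle using (ExcludedMiddle)
open import Data.Bool.Properties using (T-irrelevant)
open import Data.Empty using (⊥; ⊥-elim)
open import Data.Fin as Fin using (Fin; toℕ; fromℕ<)
open import Data.Fin.Permutation.Components using (transpose)
import Data.Fin.Properties as Fin
open import Data.Integer as ℤ using (ℤ)
open import Data.List as List
  using (List; []; _∷_; _∷ʳ_; _++_; length; foldl; applyUpTo; upTo; cartesianProduct; cartesianProductWith)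
open import Data.List.Membership.Propositional using (_∈_; _∉_)
open import Data.List.Membership.Propositional.Properties
  using (∈-map⁺; ∈-map⁻; ∈-applyUpTo⁺; ∈-applyUpTo⁻; ∈-upTo⁺; ∈-cartesianProduct⁺;
         ∈-cartesianProductWith⁺; ∈-++⁺ˡ; ∈-++⁺ʳ)
open import Data.List.Properties using (foldl-++; length-map)
open import Data.List.Relation.Unary.All as All using (All; []; _∷_)
open import Data.List.Relation.Unary.Any as Any using (here; there)
open import Data.List.Relation.Unary.Any.Properties using (lookup-index)
open import Data.Nat
open import Data.Nat.Properties
open import Data.Product using (Σ-syntax; ∃-syntax; _×_; _,_; proj₁; proj₂)
open import Data.Product.Function.NonDependent.Propositional using (_×-↠_)
open import Data.Rational as ℚ using (ℚ)
import Data.Rational.Properties as ℚ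
open import Data.Sum as Sum using (_⊎_; inj₁; inj₂; [_,_]′)
open import Data.Unit using (⊤; tt)
open import Data.Vec as Vec using (Vec; lookup; tabulate; allFin)
open import Data.Vec.Membership.Propositional using () renaming (_∈_ to _occursIn_)
open import Data.Vec.Membership.Propositional.Properties using (∈-tabulate⁺)
open import Data.Vec.Properties
  using (lookup-map; lookup∘tabulate; tabulate∘lookup; tabulate-cong; map-∘; map-cong;
         lookup∘update; lookup∘update′; lookup-allFin; map-lookup-allFin; toList∘fromList)
open import Function.Base using (_∘_; id)
open import Function.Bundles using (_↠_; mk↠ₛ; mk↣; module Surjection; module Injection)
open import Function.Construct.Composition using (_↠-∘_)
open import Function.Construct.Identity using (↠-id)
open import Level using (Level; 0ℓ)
open import Relation.Binary.Definitions using (tri<; tri≈; tri>)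
open import Relation.Binary.PropositionalEquality
open import Relation.Nullary
open import Relation.Nullary.Decidable using (True; toWitness; fromWitness)
open import Relation.Unary using (Pred)

open Surjection using (to; to⁻; to∘to⁻)

-- Enumerations

nextPair : ℕ × ℕ → ℕ × ℕ
nextPair (zero  , b) = suc b , zero
nextPair (suc a , b) = a , suc b

unpair : ℕ → ℕ × ℕ
unpair zero    = zero , zero
unpair (suc m) = nextPair (unpair m)

unpair-surjective : ∀ p → ∃[ m ] unpair m ≡ p
unpair-surjective (a , b) = onDiagonal (a + b) a b refl
  where
  onDiagonal : ∀ s a b → a + b ≡ s → ∃[ m ] unpair m ≡ (a , b)
  onDiagonal s       a       (suc b) a+b≡s
    with m , e ← onDiagonal s (suc a) b (trans (sym (+-suc a b)) a+b≡s)
    = suc m , cong nextPair e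
  onDiagonal s       zero    zero    _     = zero , refl
  onDiagonal (suc s) (suc a) zero    a+b≡s
    with m , e ← onDiagonal s zero a (trans (sym (+-identityʳ a)) (suc-injective a+b≡s))
    = suc m , cong nextPair e

abstract
  ℕ↠ℕ×ℕ : ℕ ↠ (ℕ × ℕ)
  ℕ↠ℕ×ℕ = mk↠ₛ unpair-surjective

abstract
  ℕ↠× : ∀ {A B : Set} → ℕ ↠ A → ℕ ↠ B → ℕ ↠ (A × B)
  ℕ↠× A B = (A ×-↠ B) ↠-∘ ℕ↠ℕ×ℕ

abstract
  ℕ↠⊎ : ∀ {A B : Set} → ℕ ↠ A → ℕ ↠ B → ℕ ↠ (A ⊎ B)
  ℕ↠⊎ {A} {B} eA eB = mk↠ₛ surjective ↠-∘ ℕ↠ℕ×ℕ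
    where
    enum : ℕ × ℕ → A ⊎ B
    enum (zero  , m) = inj₁ (to eA m)
    enum (suc _ , m) = inj₂ (to eB m)
    surjective : ∀ x → ∃[ p ] enum p ≡ x
    surjective (inj₁ a) = (0 , to⁻ eA a) , cong inj₁ (to∘to⁻ eA a)
    surjective (inj₂ b) = (1 , to⁻ eB b) , cong inj₂ (to∘to⁻ eB b)

module _ {A : Set} (eA : ℕ ↠ A) where

  vecFrom : ∀ n → ℕ → Vec A n
  vecFrom zero    _ = Vec.[]
  vecFrom (suc n) m = to eA (proj₁ (to ℕ↠ℕ×ℕ m)) Vec.∷ vecFrom n (proj₂ (to ℕ↠ℕ×ℕ m))

  vecFrom-surjective : ∀ {n} (xs : Vec A n) → ∃[ m ] vecFrom n m ≡ xs
  vecFrom-surjective Vec.[] = 0 , refl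
  vecFrom-surjective (x Vec.∷ xs)
    with l , refl ← vecFrom-surjective xs
    = to⁻ ℕ↠ℕ×ℕ p , cong₂ Vec._∷_ (trans (cong (to eA ∘ proj₁) e) (to∘to⁻ eA x))
                                  (cong (vecFrom _ ∘ proj₂) e)
    where
    p = to⁻ eA x , l
    e = to∘to⁻ ℕ↠ℕ×ℕ p

  abstract
    ℕ↠Vec : ∀ n → ℕ ↠ Vec A n
    ℕ↠Vec n = mk↠ₛ vecFrom-surjective

    ℕ↠List : ℕ ↠ List A
    ℕ↠List = mk↠ₛ surjective ↠-∘ ℕ↠ℕ×ℕ
      where
      surjective : ∀ xs → ∃[ p ] Vec.toList (vecFrom (proj₁ p) (proj₂ p)) ≡ xs
      surjective xs with m , e ← vecFrom-surjective (Vec.fromList xs)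
        = (List.length xs , m) , trans (cong Vec.toList e) (toList∘fromList xs)

abstract
  ℕ↠Fin : ∀ n → ℕ ↠ Fin (suc n)
  ℕ↠Fin n = mk↠ₛ surjective
    where
    enum : ℕ → Fin (suc n)
    enum m with m <? suc n
    ... | yes m<n = fromℕ< m<n
    ... | no  _   = Fin.zero
    surjective : ∀ i → ∃[ m ] enum m ≡ i
    surjective i = toℕ i , enum-toℕ
      where
      enum-toℕ : enum (toℕ i) ≡ i
      enum-toℕ with toℕ i <? suc n
      ... | yes i<n = Fin.fromℕ<-toℕ i i<n
      ... | no  i≮n = contradiction (Fin.toℕ<n i) i≮n

abstract
  ℕ↠ℚ : ℕ ↠ ℚ
  ℕ↠ℚ = mk↠ₛ surjective ↠-∘ ℕ↠× (ℕ↠⊎ (↠-id ℕ) (↠-id ℕ)) (↠-id ℕ)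
    where
    numerator : ℕ ⊎ ℕ → ℤ
    numerator (inj₁ a) = ℤ.+ a
    numerator (inj₂ a) = ℤ.-[1+ a ]
    fraction : (ℕ ⊎ ℕ) × ℕ → ℚ
    fraction (x , d) = numerator x ℚ./ suc d
    surjective : ∀ q → ∃[ p ] fraction p ≡ q
    surjective q@(ℚ.mkℚ (ℤ.+ a)      d _) = (inj₁ a , d) , ℚ.↥p/↧p≡p q
    surjective q@(ℚ.mkℚ (ℤ.-[1+ a ]) d _) = (inj₂ a , d) , ℚ.↥p/↧p≡p q

-- Digits of a real number

-- For every rational interval (p , q), x has at most one digit v, the one for
-- which x lies between the v-th and the next term of a sequence p < … < q.

Lower<¬Lower : ∀ x {p r} → Lower x p → ¬ Lower x r → p ℚ.< r
Lower<¬Lower x {p} {r} p<x r≮x with ℚ.<-cmp p r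
... | tri< p<r _ _    = p<r
... | tri≈ _ refl _   = contradiction p<x r≮x
... | tri> _ _ r<p    = contradiction (downward x r<p p<x) r≮x

toward : ℚ → ℚ → ℚ
toward q a with a ℚ.<? q
... | yes a<q = proj₁ (ℚ.<-dense a<q)
... | no  _   = a

toward-≥ : ∀ q a → a ℚ.≤ toward q a
toward-≥ q a with a ℚ.<? q
... | yes a<q = ℚ.<⇒≤ (proj₁ (proj₂ (ℚ.<-dense a<q)))
... | no  _   = ℚ.≤-refl

toward-between : ∀ {q a} → a ℚ.< q → a ℚ.< toward q a × toward q a ℚ.< q
toward-between {q} {a} a<q with a ℚ.<? q
... | yes a<q′ = proj₂ (ℚ.<-dense a<q′)
... | no  a≮q  = contradiction a<q a≮q

mark : ℚ × ℚ → ℕ → ℚ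
mark (p , q) zero    = p
mark (p , q) (suc v) = toward q (mark (p , q) v)

mark-mono : ∀ u {v w} → v ≤′ w → mark u v ℚ.≤ mark u w
mark-mono u ≤′-refl                        = ℚ.≤-refl
mark-mono u@(_ , q) (≤′-step {n = w} v≤w) =
  ℚ.≤-trans (mark-mono u v≤w) (toward-≥ q (mark u w))

mark-< : ∀ {p q} v → p ℚ.< q → mark (p , q) v ℚ.< q
mark-< zero    p<q = p<q
mark-< (suc v) p<q = proj₂ (toward-between (mark-< v p<q))

HasDigit : ℝ → ℚ × ℚ → ℕ → Set
HasDigit x u v = ⦅ mark u v , mark u (suc v) ⦆ x

HasDigit-≮ : ∀ {x u v w} → HasDigit x u v → HasDigit x u w → ¬ v < w
HasDigit-≮ {x} {u} (_ , r , r<v+1 , r≮x) (w<x , _) v<w =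
  r≮x (downward x (ℚ.<-≤-trans r<v+1 (mark-mono u (≤⇒≤′ v<w))) w<x)

HasDigit-functional : ∀ {x u v w} → HasDigit x u v → HasDigit x u w → v ≡ w
HasDigit-functional {x} {u} {v} {w} dv dw with <-cmp v w
... | tri< v<w _ _ = contradiction v<w (HasDigit-≮ {x} {u} dv dw)
... | tri≈ _ v≡w _ = v≡w
... | tri> _ _ w<v = contradiction w<v (HasDigit-≮ {x} {u} dw dv)

fromℚ : ∀ {l m} → l ℚ.< m → ℝ
fromℚ {l} {m} l<m = record
  { Lower     = ℚ._< m
  ; inhabited = l , l<m
  ; proper    = m , ℚ.<-irrefl refl
  ; downward  = ℚ.<-trans
  ; no-max    = λ p<m → let q , p<q , q<m = ℚ.<-dense p<m in q , p<q , q<m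
  }

avoidsDigits-nowhereDense : ∀ (d : ℚ × ℚ → ℕ) → NowhereDense (λ x → ∀ u → ¬ HasDigit x u (d u))
avoidsDigits-nowhereDense d x (p , q , (p<x , r , r<q , r≮x) , ⊆closure) =
  let u             = p , q
      a             = mark u (d u)
      p<q           = ℚ.<-trans (Lower<¬Lower x p<x r≮x) r<q
      a<b , b<q     = toward-between (mark-< (d u) p<q)
      m , a<m , m<b = ℚ.<-dense a<b
      p≤a           = mark-mono u (≤⇒≤′ (z≤n {d u}))
      y             = fromℚ a<m
      z , z∈ab , z∉ = ⊆closure {y} (ℚ.≤-<-trans p≤a a<m , m , ℚ.<-trans m<b b<q , ℚ.<-irrefl refl)
                        _ _ (a<m , m , m<b , ℚ.<-irrefl refl)
  in z∉ u z∈ab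

-- Growth of functions

Increasing : (ℕ → ℕ) → Set
Increasing g = ∀ k → g k < g (suc k)

increasing⇒monotone : ∀ {g} → Increasing g → ∀ {k l} → k ≤′ l → g k ≤ g l
increasing⇒monotone inc ≤′-refl               = ≤-refl
increasing⇒monotone inc (≤′-step {n = l} k≤l) =
  ≤-trans (increasing⇒monotone inc k≤l) (<⇒≤ (inc l))

increasing⇒≥ : ∀ {g} → Increasing g → ∀ k → k ≤ g k
increasing⇒≥ inc zero    = z≤n
increasing⇒≥ inc (suc k) = ≤-<-trans (increasing⇒≥ inc k) (inc k)

bracket : ∀ {b} → Increasing b → b 0 ≡ 0 → ∀ m → ∃[ k ] b k ≤ m × m < b (suc k)
bracket {b} inc b0≡0 zero    = 0 , ≤-reflexive b0≡0 , ≤-<-trans z≤n (inc 0)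
bracket {b} inc b0≡0 (suc m) with k , bk≤m , m<b ← bracket {b} inc b0≡0 m
  with suc m <? b (suc k)
... | yes 1+m<b = k , m≤n⇒m≤1+n bk≤m , 1+m<b
... | no  1+m≮b = suc k , ≮⇒≥ 1+m≮b , ≤-<-trans m<b (inc (suc k))

increasingHull : (ℕ → ℕ) → ℕ → ℕ
increasingHull f zero    = suc (f 0)
increasingHull f (suc k) = suc (increasingHull f k ⊔ f (suc k))

increasingHull-increasing : ∀ f → Increasing (increasingHull f)
increasingHull-increasing f k = s≤s (m≤m⊔n _ _)

increasingHull-> : ∀ f k → f k < increasingHull f k
increasingHull-> f zero    = ≤-refl
increasingHull-> f (suc k) = s≤s (m≤n⊔m (increasingHull f k) _)

iterateFrom0 : (ℕ → ℕ) → ℕ → ℕ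
iterateFrom0 g zero    = 0
iterateFrom0 g (suc k) = g (iterateFrom0 g k)

-- Let b be the orbit of 0 under g.  If b k ≤ m < b (k + 1) and
-- h (h m) < g m, then h (b k) < b (k + 1) or h (b (k + 1)) < b (k + 2).
leaps : ∀ {g h} → (∀ k → k < g k) → Increasing g → Increasing h →
        (∀ m → ∃[ k ] m ≤ k × h (h k) < g k) →
        let b = iterateFrom0 g in
        ∀ m → ∃[ k ] m ≤ k × h (b k) < b (suc k)
leaps {g} {h} g> g-inc h-inc often m
  with l , bm≤l , hhl<gl ← often (iterateFrom0 g m)
  with k , bk≤l , l<b ← bracket {iterateFrom0 g} (g> ∘ iterateFrom0 g) refl l
  = leap
  where
  b = iterateFrom0 g
  b-inc : Increasing b
  b-inc = g> ∘ b
  m≤k : m ≤ k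
  m≤k = ≮⇒≥ λ k<m → <⇒≱ l<b (≤-trans (increasing⇒monotone {b} b-inc (≤⇒≤′ k<m)) bm≤l)
  leap : ∃[ k ] m ≤ k × h (b k) < b (suc k)
  leap with h (b k) <? b (suc k)
  ... | yes hb<b = k , m≤k , hb<b
  ... | no  hb≮b = suc k , m≤n⇒m≤1+n m≤k , (begin-strict
    h (b (suc k)) ≤⟨ increasing⇒monotone {h} h-inc (≤⇒≤′ (≮⇒≥ hb≮b)) ⟩
    h (h (b k))   ≤⟨ increasing⇒monotone {h} h-inc (≤⇒≤′ (increasing⇒monotone {h} h-inc (≤⇒≤′ bk≤l))) ⟩
    h (h l)       <⟨ hhl<gl ⟩
    g l           ≤⟨ increasing⇒monotone {g} g-inc (≤⇒≤′ (<⇒≤ l<b)) ⟩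
    b (suc (suc k)) ∎)
    where open ≤-Reasoning

-- Tuples and maps of coordinates

lookup-injective : ∀ {A : Set} {n} (s t : Vec A n) → (∀ i → lookup s i ≡ lookup t i) → s ≡ t
lookup-injective s t e = trans (sym (tabulate∘lookup s)) (trans (tabulate-cong e) (tabulate∘lookup t))

lookup-∘ᵥ : ∀ {M : Set} {n} (s : Vec M n) τ i → lookup (s ∘ᵥ τ) i ≡ lookup s (lookup τ i)
lookup-∘ᵥ s τ i = lookup-map i (lookup s) τ

transpose-involutive : ∀ {n} (i j k : Fin n) → transpose i j (transpose i j k) ≡ k
transpose-involutive i j k with k Fin.≟ i
transpose-involutive i j k | yes refl with j Fin.≟ i
... | yes j≡i = j≡i
... | no  _ with j Fin.≟ j
...   | yes _   = refl
...   | no  j≢j = contradiction refl j≢j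
transpose-involutive i j k | no k≢i with k Fin.≟ j
transpose-involutive i j k | no k≢i | yes refl with i Fin.≟ i
...   | yes _   = refl
...   | no  i≢i = contradiction refl i≢i
transpose-involutive i j k | no k≢i | no k≢j with k Fin.≟ i
...   | yes k≡i = contradiction k≡i k≢i
...   | no  _ with k Fin.≟ j
...     | yes k≡j = contradiction k≡j k≢j
...     | no  _   = refl

transposition : ∀ {n} → Fin n → Fin n → Vec (Fin n) n
transposition i j = tabulate (transpose i j)

module _ {R : Set} {n : ℕ} where

  permute : (Fin n → Fin n) → Formula R n G → Formula R n G
  permute f (rel r)     = relAt r (tabulate f)
  permute f (relAt r τ) = relAt r (Vec.map f τ)
  permute f (eq i j)    = eq (f i) (f j)
  permute f ⊥′          = ⊥′
  permute f (φ ∧′ ψ)    = permute f φ ∧′ permute f ψ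
  permute f (φ ∨′ ψ)    = permute f φ ∨′ permute f ψ
  permute f (φ ⇒′ ψ)    = permute f φ ⇒′ permute f ψ
  permute f (∃′ i φ)    = ∃′ (f i) (permute f φ)

  module _ (𝔐 : Model R n G) (f : Fin n → Fin n) (involutive : ∀ i → f (f i) ≡ i) where
    open Model 𝔐 using (Base; V; isUnit; ⟦_⟧)

    infixl 9 _∘f
    _∘f : Vec Base n → Vec Base n
    s ∘f = s ∘ᵥ tabulate f

    lookup-∘f : ∀ s i → lookup (s ∘f) i ≡ lookup s (f i)
    lookup-∘f s i = trans (lookup-∘ᵥ s (tabulate f) i) (cong (lookup s) (lookup∘tabulate f i))

    ∘f-involutive : ∀ s → s ∘f ∘f ≡ s
    ∘f-involutive s = lookup-injective _ _ λ i →
      trans (lookup-∘f (s ∘f) i) (trans (lookup-∘f s (f i)) (cong (lookup s) (involutive i)))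

    ∘f-∘ᵥ : ∀ s τ → (s ∘f) ∘ᵥ τ ≡ s ∘ᵥ Vec.map f τ
    ∘f-∘ᵥ s τ = trans (map-cong (lookup-∘f s) τ) (map-∘ (lookup s) f τ)

    permute⁺ : ∀ φ {s} → Sat 𝔐 (s ∘f) φ → Sat 𝔐 s (permute f φ)
    permute⁻ : ∀ φ {s} → Sat 𝔐 s (permute f φ) → Sat 𝔐 (s ∘f) φ

    permute⁺ (rel r)         p        = p
    permute⁺ (relAt r τ) {s} p        = subst ⟦ r ⟧ (∘f-∘ᵥ s τ) p
    permute⁺ (eq i j)    {s} p        = trans (sym (lookup-∘f s i)) (trans p (lookup-∘f s j))
    permute⁺ (φ ∧′ ψ)        (p , q)  = permute⁺ φ p , permute⁺ ψ q
    permute⁺ (φ ∨′ ψ)        (inj₁ p) = inj₁ (permute⁺ φ p)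
    permute⁺ (φ ∨′ ψ)        (inj₂ q) = inj₂ (permute⁺ ψ q)
    permute⁺ (φ ⇒′ ψ)        p        = permute⁺ ψ ∘ p ∘ permute⁻ φ
    permute⁺ (∃′ i φ)    {s} (t , t∈ , t≈s , p) =
      t ∘f , isUnit t t∈ (tabulate f) ,
      (λ j j≢fi → trans (lookup-∘f t j)
        (trans (t≈s (f j) λ fj≡i → j≢fi (trans (sym (involutive j)) (cong f fj≡i)))
          (trans (lookup-∘f s (f j)) (cong (lookup s) (involutive j))))) ,
      permute⁺ φ (subst (λ t → Sat 𝔐 t φ) (sym (∘f-involutive t)) p)

    permute⁻ (rel r)         p        = p
    permute⁻ (relAt r τ) {s} p        = subst ⟦ r ⟧ (sym (∘f-∘ᵥ s τ)) p
    permute⁻ (eq i j)    {s} p        = trans (lookup-∘f s i) (trans p (sym (lookup-∘f s j)))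
    permute⁻ (φ ∧′ ψ)        (p , q)  = permute⁻ φ p , permute⁻ ψ q
    permute⁻ (φ ∨′ ψ)        (inj₁ p) = inj₁ (permute⁻ φ p)
    permute⁻ (φ ∨′ ψ)        (inj₂ q) = inj₂ (permute⁻ ψ q)
    permute⁻ (φ ⇒′ ψ)        p        = permute⁻ ψ ∘ p ∘ permute⁺ φ
    permute⁻ (∃′ i φ)    {s} (t , t∈ , t≈s , p) =
      t ∘f , isUnit t t∈ (tabulate f) ,
      (λ j j≢i → trans (lookup-∘f t j)
        (trans (t≈s (f j) λ fj≡fi → j≢i (trans (sym (involutive j)) (trans (cong f fj≡fi) (involutive i))))
          (sym (lookup-∘f s j)))) ,
      permute⁻ φ p

data Key (R : Set) (n : ℕ) : Kind → Set where
  wit  : ∀ {k} → Fin n → Formula R n k → Key R n k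
  swap : Fin n → Fin n → Key R n G

upToFin : ∀ {n ℓ} (Q : ℕ → Set ℓ) → Q 0 → (∀ (i : Fin n) → Q (toℕ i) → Q (suc (toℕ i))) → Q n
upToFin {n} Q q₀ step = go n ≤-refl
  where
  go : ∀ m → m ≤ n → Q m
  go zero    _   = q₀
  go (suc m) m<n = subst (Q ∘ suc) (Fin.toℕ-fromℕ< m<n)
    (step (fromℕ< m<n) (subst Q (sym (Fin.toℕ-fromℕ< m<n)) (go m (<⇒≤ m<n))))

module _ {M : Set} {n : ℕ} (s : Vec M n) where

  lookup-∘transposition : ∀ i j l → lookup (s ∘ᵥ transposition i j) l ≡ lookup s (transpose i j l)
  lookup-∘transposition i j l =
    trans (lookup-∘ᵥ s (transposition i j) l) (cong (lookup s) (lookup∘tabulate (transpose i j) l))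

  lookup-∘replacement-≡ : ∀ i j → lookup (s ∘ᵥ [ i ∣ j ]) i ≡ lookup s j
  lookup-∘replacement-≡ i j =
    trans (lookup-∘ᵥ s [ i ∣ j ] i) (cong (lookup s) (lookup∘update i (allFin n) j))

  lookup-∘replacement-≢ : ∀ {i l} j → l ≢ i → lookup (s ∘ᵥ [ i ∣ j ]) l ≡ lookup s l
  lookup-∘replacement-≢ {i} {l} j l≢i = trans (lookup-∘ᵥ s [ i ∣ j ] l)
    (cong (lookup s) (trans (lookup∘update′ l≢i (allFin n) j) (lookup-allFin l)))

transpose-at : ∀ {n} (i j : Fin n) → transpose i j i ≡ j
transpose-at i j with i Fin.≟ i
... | yes _   = refl
... | no  i≢i = contradiction refl i≢i

transpose-off : ∀ {n} (i j l : Fin n) → l ≢ i → l ≢ j → transpose i j l ≡ l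
transpose-off i j l l≢i l≢j with l Fin.≟ i
... | yes l≡i = contradiction l≡i l≢i
... | no  _ with l Fin.≟ j
...   | yes l≡j = contradiction l≡j l≢j
...   | no  _   = refl

-- Put the first occurrence of every value of τ in place by transpositions;
-- the other occurrences are then copied from the first ones.
module _ {n : ℕ} (P : Pred (Vec (Fin n) n) 0ℓ) (P-id : P (allFin n))
         (P-transposition : ∀ σ i j → P σ → P (σ ∘ᵥ transposition i j))
         (P-replacement : ∀ σ i j → P σ → P (σ ∘ᵥ [ i ∣ j ])) (τ : Vec (Fin n) n) where

  private
    First : Fin n → Set
    First j = ∀ l → l Fin.< j → lookup τ l ≢ lookup τ j

    first? : ∀ j → First j ⊎ ∃[ l ] l Fin.< j × lookup τ l ≡ lookup τ j
    first? j with Fin.any? (λ l → (l Fin.<? j) ×-dec (lookup τ l Fin.≟ lookup τ j))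
    ... | yes (l , l<j , e) = inj₂ (l , l<j , e)
    ... | no  ∄             = inj₁ λ l l<j e → ∄ (l , l<j , e)

    Placed : ℕ → Set
    Placed m = ∃[ σ ] P σ × (∀ v → ∃[ j ] lookup σ j ≡ v) ×
               (∀ j → toℕ j < m → First j → lookup σ j ≡ lookup τ j)

    Copied : ℕ → Set
    Copied m = ∃[ σ ] P σ × (∀ j → First j ⊎ toℕ j < m → lookup σ j ≡ lookup τ j)

    <suc⇒ : ∀ {i l : Fin n} → toℕ l < suc (toℕ i) → l ≢ i → l Fin.< i
    <suc⇒ l<1+i l≢i = ≤∧≢⇒< (≤-pred l<1+i) (l≢i ∘ Fin.toℕ-injective)

    place : ∀ i → Placed (toℕ i) → Placed (suc (toℕ i))
    place i (σ , Pσ , onto , placed) with first? i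
    ... | inj₂ (l , l<i , e) = σ , Pσ , onto , λ j j<1+i first-j →
      placed j (<suc⇒ j<1+i λ { refl → first-j l l<i e }) first-j
    ... | inj₁ first-i with j , σj≡τi ← onto (lookup τ i) = σ′ , P-transposition σ i j Pσ , onto′ , placed′
      where
      σ′ = σ ∘ᵥ transposition i j
      lookup-σ′ : ∀ l → lookup σ′ l ≡ lookup σ (transpose i j l)
      lookup-σ′ = lookup-∘transposition σ i j
      onto′ : ∀ v → ∃[ l ] lookup σ′ l ≡ v
      onto′ v with l , e ← onto v = transpose i j l ,
        trans (lookup-σ′ _) (trans (cong (lookup σ) (transpose-involutive i j l)) e)
      placed′ : ∀ l → toℕ l < suc (toℕ i) → First l → lookup σ′ l ≡ lookup τ l
      placed′ l l<1+i first-l with l Fin.≟ i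
      ... | yes refl = trans (lookup-σ′ l) (trans (cong (lookup σ) (transpose-at l j)) σj≡τi)
      ... | no  l≢i  = trans (lookup-σ′ l) (trans (cong (lookup σ) (transpose-off i j l l≢i l≢j)) σl≡τl)
        where
        l<i : l Fin.< i
        l<i = <suc⇒ l<1+i l≢i
        σl≡τl : lookup σ l ≡ lookup τ l
        σl≡τl = placed l l<i first-l
        l≢j : l ≢ j
        l≢j refl = first-i l l<i (trans (sym σl≡τl) σj≡τi)

    copy : ∀ i → Copied (toℕ i) → Copied (suc (toℕ i))
    copy i (σ , Pσ , copied) with first? i
    ... | inj₁ first-i = σ , Pσ , copied′
      where
      copied′ : ∀ j → First j ⊎ toℕ j < suc (toℕ i) → lookup σ j ≡ lookup τ j
      copied′ j (inj₁ first-j) = copied j (inj₁ first-j)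
      copied′ j (inj₂ j<1+i) with j Fin.≟ i
      ... | yes refl = copied j (inj₁ first-i)
      ... | no  j≢i  = copied j (inj₂ (<suc⇒ j<1+i j≢i))
    ... | inj₂ (l , l<i , e) = σ ∘ᵥ [ i ∣ l ] , P-replacement σ i l Pσ , copied′
      where
      copied′ : ∀ j → First j ⊎ toℕ j < suc (toℕ i) → lookup (σ ∘ᵥ [ i ∣ l ]) j ≡ lookup τ j
      copied′ j p with j Fin.≟ i
      ... | yes refl = trans (lookup-∘replacement-≡ σ i l) (trans (copied l (inj₂ l<i)) e)
      ... | no  j≢i  = trans (lookup-∘replacement-≢ σ l j≢i)
                         (copied j (Sum.map id (λ j<1+i → <suc⇒ j<1+i j≢i) p))

  generated : P τ
  generated
    with σ , Pσ , _ , placed ← upToFin Placed (allFin n , P-id , (λ v → v , lookup-allFin v) , λ _ ()) place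
    with σ′ , Pσ′ , copied ← upToFin Copied (σ , Pσ , λ { j (inj₁ first-j) → placed j (Fin.toℕ<n j) first-j }) copy
    = subst P (lookup-injective σ′ τ λ j → copied j (inj₂ (Fin.toℕ<n j))) Pσ′

∘ᵥ-assoc : ∀ {M : Set} {n} (s : Vec M n) σ τ → (s ∘ᵥ σ) ∘ᵥ τ ≡ s ∘ᵥ (σ ∘ᵥ τ)
∘ᵥ-assoc s σ τ = lookup-injective _ _ λ i →
  trans (lookup-∘ᵥ (s ∘ᵥ σ) τ i) (trans (lookup-∘ᵥ s σ (lookup τ i))
    (sym (trans (lookup-∘ᵥ s (σ ∘ᵥ τ) i) (cong (lookup s) (lookup-∘ᵥ σ τ i)))))

isUnit-G : ∀ {M : Set} {n} (V : Pred (Vec M n) 0ℓ) →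
           (∀ s i j → V s → V (s ∘ᵥ transposition i j)) → (∀ s i j → V s → V (s ∘ᵥ [ i ∣ j ])) →
           IsUnit G V
isUnit-G V closed-transposition closed-replacement s s∈ =
  generated (λ τ → V (s ∘ᵥ τ)) (subst V (sym (map-lookup-allFin s)) s∈)
    (λ σ i j p → subst V (∘ᵥ-assoc s σ _) (closed-transposition (s ∘ᵥ σ) i j p))
    (λ σ i j p → subst V (∘ᵥ-assoc s σ _) (closed-replacement (s ∘ᵥ σ) i j p))

unit-replacement : ∀ k {M : Set} {n} {V : Pred (Vec M n) 0ℓ} → IsUnit k V →
                   ∀ s i j → V s → V (s ∘ᵥ [ i ∣ j ])
unit-replacement D isUnit s i j s∈ = isUnit s s∈ i j
unit-replacement G isUnit s i j s∈ = isUnit s s∈ [ i ∣ j ]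

isUnit-generated : ∀ k {M : Set} {n} (V : Pred (Vec M n) 0ℓ) → (∀ s i j → V s → V (s ∘ᵥ [ i ∣ j ])) →
                   (k ≡ G → ∀ s i j → V s → V (s ∘ᵥ transposition i j)) → IsUnit k V
isUnit-generated D V replacement transposition s s∈ i j = replacement s i j s∈
isUnit-generated G V replacement transposition = isUnit-G V (transposition refl) replacement

module Classical (em : ∀ ℓ → ExcludedMiddle ℓ) where

  decide : ∀ {ℓ} (P : Set ℓ) → Dec P
  decide P = em _ {P}

  byContradiction : ∀ {ℓ} {P : Set ℓ} → ¬ ¬ P → P
  byContradiction {P = P} = decidable-stable (decide P)

  Guessable : Set → Set
  Guessable I = ∀ (f : I → ℕ → ℕ) → Σ[ t ∈ (ℕ → ℕ) ] ∀ i → ∃[ k ] t k ≡ f i k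

  countable⇒guessable : ∀ {I} → Countable I → Guessable I
  countable⇒guessable {I} c f = t , λ i → code i , guessed i
    where
    open Injection c using (injective) renaming (to to code)
    t : ℕ → ℕ
    t k with decide (∃[ i ] code i ≡ k)
    ... | yes (i , _) = f i k
    ... | no  _       = 0
    guessed : ∀ i → t (code i) ≡ f i (code i)
    guessed i with decide (∃[ j ] code j ≡ code i)
    ... | yes (j , e) = cong (λ x → f x (code i)) (injective e)
    ... | no  ∄       = contradiction (i , refl) ∄

  ¬covers⇒guessable : ∀ {I} → ¬ CoversLine I → Guessable I
  ¬covers⇒guessable {I} ¬covers f = byContradiction λ ∄t → ¬covers
    ( (λ i x → ∀ u → ¬ HasDigit x u (d i u))
    , (λ i (x⊆y , y⊆x) avoids u (l , r , r<v+1 , r≮) → avoids u (y⊆x l , r , r<v+1 , r≮ ∘ x⊆y))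
    , (λ i → avoidsDigits-nowhereDense (d i))
    , (λ x → byContradiction λ ∄i → ∄t (digit x , λ i →
         let u , has = byContradiction λ ∄u → ∄i (i , λ u has → ∄u (u , has))
         in to⁻ e u , digit-unique x {to⁻ e u} {d i u} (subst (λ u′ → HasDigit x u′ (d i u)) (sym (to∘to⁻ e u)) has)))
    )
    where
    e : ℕ ↠ (ℚ × ℚ)
    e = ℕ↠× ℕ↠ℚ ℕ↠ℚ
    d : I → ℚ × ℚ → ℕ
    d i u = f i (to⁻ e u)
    digit : ℝ → ℕ → ℕ
    digit x k with decide (∃[ v ] HasDigit x (to e k) v)
    ... | yes (v , _) = v
    ... | no  _       = 0
    digit-unique : ∀ x {k v} → HasDigit x (to e k) v → digit x k ≡ v
    digit-unique x {k} {v} has with decide (∃[ v ] HasDigit x (to e k) v)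
    ... | yes (w , has′) = HasDigit-functional {x} {to e k} {w} {v} has′ has
    ... | no  ∄          = contradiction (v , has) ∄

  -- Guessing infinitely often

  Infinite : Pred ℕ 0ℓ → Set
  Infinite Y = ∀ m → ∃[ k ] m ≤ k × Y k

  module _ {Y : Pred ℕ 0ℓ} (inf : Infinite Y) (l : ℕ) where

    element : ℕ → ℕ
    element zero    = proj₁ (inf l)
    element (suc j) = proj₁ (inf (suc (element j)))

    element-∈ : ∀ j → Y (element j)
    element-∈ zero    = proj₂ (proj₂ (inf l))
    element-∈ (suc j) = proj₂ (proj₂ (inf (suc (element j))))

    element-< : ∀ {i j} → i <′ j → element i < element j
    element-< {i} ≤′-refl               = proj₁ (proj₂ (inf (suc (element i))))
    element-< {i} (≤′-step {n = j} i<j) =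
      <-trans (element-< i<j) (proj₁ (proj₂ (inf (suc (element j)))))

    element-≥ : ∀ j → l ≤ element j
    element-≥ zero    = proj₁ (proj₂ (inf l))
    element-≥ (suc j) = ≤-trans (element-≥ j) (<⇒≤ (element-< {j} ≤′-refl))

    element-escapes : ∀ ks → ∃[ j ] j ≤ length ks × element j ∉ ks
    element-escapes ks = byContradiction λ ∄j →
      let ∈ks : ∀ j → element (toℕ j) ∈ ks
          ∈ks = λ (j : Fin (suc (length ks))) → byContradiction λ ∉ks →
                  ∄j (toℕ j , ≤-pred (Fin.toℕ<n j) , ∉ks)
          i , j , i<j , e = Fin.pigeonhole (n<1+n (length ks)) (Any.index ∘ ∈ks)
      in <⇒≢ (element-< (≤⇒≤′ i<j))
             (trans (lookup-index (∈ks i)) (trans (cong (List.lookup ks) e) (sym (lookup-index (∈ks j)))))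

  abstract
    -- The guesses are lists of arguments with values; a list of length q + 1
    -- always contains an argument not used by the q guesses before it.
    guessable∞ : ∀ {I} → Guessable I → (f : I → ℕ → ℕ) {Y : I → Pred ℕ 0ℓ} →
                 (∀ i → Infinite (Y i)) →
                 Σ[ t ∈ (ℕ → ℕ) ] ∀ i m → ∃[ k ] m ≤ k × Y i k × t k ≡ f i k
    guessable∞ {I} guessable f {Y} inf = t , guessed
      where
      e : ℕ ↠ List (ℕ × ℕ)
      e = ℕ↠List ℕ↠ℕ×ℕ
      answer : I → ℕ → ℕ → ℕ × ℕ
      answer i l j = let y = element (inf i) l j in y , f i y
      answers : I → ℕ → ℕ → List (ℕ × ℕ)
      answers i l k = applyUpTo (answer i l) (suc (to⁻ ℕ↠ℕ×ℕ (l , k)))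
      guessCode : ∀ l → Σ[ t ∈ (ℕ → ℕ) ] ∀ i → ∃[ k ] t k ≡ to⁻ e (answers i l k)
      guessCode l = guessable λ i k → to⁻ e (answers i l k)
      guess : ℕ → List (ℕ × ℕ)
      guess q = to e (proj₁ (guessCode (proj₁ (to ℕ↠ℕ×ℕ q))) (proj₂ (to ℕ↠ℕ×ℕ q)))
      guess-correct : ∀ i l → ∃[ q ] guess q ≡ applyUpTo (answer i l) (suc q)
      guess-correct i l with k , e-k ← proj₂ (guessCode l) i =
        to⁻ ℕ↠ℕ×ℕ (l , k) ,
        trans (cong (λ (l , k) → to e (proj₁ (guessCode l) k)) (to∘to⁻ ℕ↠ℕ×ℕ (l , k)))
              (trans (cong (to e) e-k) (to∘to⁻ e _))

      Fresh : List (ℕ × ℕ) → ℕ × ℕ → Set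
      Fresh zs p = proj₁ p ∉ List.map proj₁ zs
      extend : List (ℕ × ℕ) → List (ℕ × ℕ) → List (ℕ × ℕ)
      extend xs zs with decide (∃[ p ] p ∈ xs × Fresh zs p)
      ... | yes (p , _) = p ∷ zs
      ... | no  _       = zs
      graph : ℕ → List (ℕ × ℕ)
      graph zero    = []
      graph (suc q) = extend (guess q) (graph q)

      extend-⊇ : ∀ xs zs {p} → p ∈ zs → p ∈ extend xs zs
      extend-⊇ xs zs p∈ with decide (∃[ p ] p ∈ xs × Fresh zs p)
      ... | yes _ = there p∈
      ... | no  _ = p∈
      graph-mono : ∀ {q r} → q ≤′ r → ∀ {p} → p ∈ graph q → p ∈ graph r
      graph-mono ≤′-refl                 p∈ = p∈
      graph-mono (≤′-step {n = r} q≤r) p∈ = extend-⊇ (guess r) (graph r) (graph-mono q≤r p∈)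

      length-extend : ∀ xs zs → length (extend xs zs) ≤ suc (length zs)
      length-extend xs zs with decide (∃[ p ] p ∈ xs × Fresh zs p)
      ... | yes _ = ≤-refl
      ... | no  _ = n≤1+n _
      length-graph : ∀ q → length (graph q) ≤ q
      length-graph zero    = z≤n
      length-graph (suc q) = ≤-trans (length-extend (guess q) (graph q)) (s≤s (length-graph q))

      Functional : List (ℕ × ℕ) → Set
      Functional zs = ∀ {y v w} → (y , v) ∈ zs → (y , w) ∈ zs → v ≡ w
      extend-functional : ∀ xs zs → Functional zs → Functional (extend xs zs)
      extend-functional xs zs fun v∈ w∈ with decide (∃[ p ] p ∈ xs × Fresh zs p)
      extend-functional xs zs fun v∈          w∈          | no _ = fun v∈ w∈
      extend-functional xs zs fun (here refl) (here refl) | yes _ = refl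
      extend-functional xs zs fun (here refl) (there w∈)  | yes (_ , _ , fresh) =
        contradiction (∈-map⁺ proj₁ w∈) fresh
      extend-functional xs zs fun (there v∈)  (here refl) | yes (_ , _ , fresh) =
        contradiction (∈-map⁺ proj₁ v∈) fresh
      extend-functional xs zs fun (there v∈)  (there w∈)  | yes _ = fun v∈ w∈
      graph-functional : ∀ q → Functional (graph q)
      graph-functional zero    ()
      graph-functional (suc q) = extend-functional (guess q) (graph q) (graph-functional q)

      t : ℕ → ℕ
      t y with decide (∃[ q ] ∃[ v ] (y , v) ∈ graph q)
      ... | yes (_ , v , _) = v
      ... | no  _           = 0
      t-value : ∀ {q y v} → (y , v) ∈ graph q → t y ≡ v
      t-value {q} {y} v∈ with decide (∃[ q ] ∃[ v ] (y , v) ∈ graph q)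
      ... | yes (r , _ , w∈) = graph-functional (q ⊔ r) (graph-mono (≤⇒≤′ (m≤n⊔m q r)) w∈)
                                                        (graph-mono (≤⇒≤′ (m≤m⊔n q r)) v∈)
      ... | no  ∄            = contradiction (q , _ , v∈) ∄

      extend-fresh : ∀ xs zs → (∃[ p ] p ∈ xs × Fresh zs p) → ∃[ p ] p ∈ xs × p ∈ extend xs zs
      extend-fresh xs zs ∃p with decide (∃[ p ] p ∈ xs × Fresh zs p)
      ... | yes (p , p∈ , _) = p , p∈ , here refl
      ... | no  ∄p           = contradiction ∃p ∄p

      guessed : ∀ i m → ∃[ k ] m ≤ k × Y i k × t k ≡ f i k
      guessed i m
        with q , guess-q ← guess-correct i m
        with j , j≤ , y∉ ← element-escapes (inf i) m (List.map proj₁ (graph q))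
        with p , p∈ , p∈graph ← extend-fresh (guess q) (graph q)
               ( answer i m j
               , subst (answer i m j ∈_) (sym guess-q)
                   (∈-applyUpTo⁺ (answer i m)
                     (s≤s (≤-trans j≤ (≤-trans (≤-reflexive (length-map proj₁ (graph q))) (length-graph q)))))
               , y∉ )
        with j′ , _ , refl ← ∈-applyUpTo⁻ (answer i m) (subst (p ∈_) guess-q p∈)
        = element (inf i) m j′ , element-≥ (inf i) m j′ , element-∈ (inf i) m j′ , t-value {q = suc q} p∈graph

  module Generic
    {ℓ : Level} {S : Set ℓ} (start : S) (act : S → ℕ → S)
    (compose : ∀ (a b : ℕ) → ∃[ c ] ∀ (s : S) → act s c ≡ act (act s a) b)
    {I : Set} (Goal : I → ℕ → Pred S 0ℓ)
    (Goal-open : ∀ {i : I} {m : ℕ} {s : S} (a : ℕ) → Goal i m s → Goal i m (act s a))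
    (Goal-dense : ∀ (i : I) (m : ℕ) (s : S) → ∃[ a ] Goal i m (act s a))
    where

    dense-uniform : ∀ i (ps : List (S × ℕ)) → ∃[ a ] All (λ (s , m) → Goal i m (act s a)) ps
    dense-uniform i []             = 0 , []
    dense-uniform i ((s , m) ∷ ps)
      with a , all ← dense-uniform i ps
      with b , d ← Goal-dense i m (act s a)
      with c , act-c ← compose a b
      = c , subst (Goal i m) (sym (act-c s)) d
          ∷ All.map (λ {(s , m)} d → subst (Goal i m) (sym (act-c s)) (Goal-open b d)) all

    reach : ℕ → ℕ → List S
    reach N zero    = start ∷ []
    reach N (suc k) = reach N k ++ cartesianProductWith act (reach N k) (upTo N)

    reach-mono : ∀ {N k l s} → k ≤′ l → s ∈ reach N k → s ∈ reach N l
    reach-mono ≤′-refl       s∈ = s∈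
    reach-mono (≤′-step k≤l) s∈ = ∈-++⁺ˡ (reach-mono k≤l s∈)

    abstract
      universal : ∀ i N → ∃[ a ] ∀ {s m} → s ∈ reach N N → m ≤ N → Goal i m (act s a)
      universal i N with a , all ← dense-uniform i (cartesianProduct (reach N N) (upTo (suc N)))
        = a , λ s∈ m≤N → All.lookup all (∈-cartesianProduct⁺ s∈ (∈-upTo⁺ (s≤s m≤N)))

    run : (ℕ → ℕ) → ℕ → S
    run t zero    = start
    run t (suc k) = act (run t k) (t k)

    -- A function that is infinitely often above h ∘ h for the growth rates h
    -- of the universal actions gives bounds b for the first k actions; below
    -- such bounds only finitely many states are possible at time k, so a
    -- universal action for these can be prescribed without knowing the run.
    generic : Guessable I → Σ[ t ∈ (ℕ → ℕ) ] ∀ i m → ∃[ k ] Goal i m (run t k)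
    generic guessable = t′ , meets
      where
      u : I → ℕ → ℕ
      u i N = proj₁ (universal i N)
      h : I → ℕ → ℕ
      h i = increasingHull (u i)
      h-inc : ∀ i → Increasing (h i)
      h-inc i = increasingHull-increasing (u i)

      escaping : Σ[ t ∈ (ℕ → ℕ) ] ∀ i m → ∃[ k ] m ≤ k × ⊤ × t k ≡ h i (h i k)
      escaping = guessable∞ guessable (λ i k → h i (h i k)) {λ _ _ → ⊤} (λ _ m → m , ≤-refl , tt)
      g : ℕ → ℕ
      g = increasingHull (proj₁ escaping)
      g-inc : Increasing g
      g-inc = increasingHull-increasing (proj₁ escaping)
      g> : ∀ k → k < g k
      g> zero    = z<s
      g> (suc k) = ≤-<-trans (g> k) (g-inc k)
      escapes : ∀ i m → ∃[ k ] m ≤ k × h i (h i k) < g k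
      escapes i m =
        let k , m≤k , _ , e = proj₂ escaping i m
        in k , m≤k , subst (_< g k) e (increasingHull-> (proj₁ escaping) k)
      b : ℕ → ℕ
      b = iterateFrom0 g
      b-inc : Increasing b
      b-inc = g> ∘ b

      guess : Σ[ t ∈ (ℕ → ℕ) ] ∀ i m →
              ∃[ k ] m ≤ k × h i (b k) < b (suc k) × t k ≡ u i (b k)
      guess = guessable∞ guessable (λ i k → u i (b k)) {λ i k → h i (b k) < b (suc k)}
                (λ i → leaps {g} {h i} g> g-inc (h-inc i) (escapes i))
      t : ℕ → ℕ
      t = proj₁ guess
      t′ : ℕ → ℕ
      t′ k with t k <? b (suc k)
      ... | yes _ = t k
      ... | no  _ = 0
      t′-< : ∀ k → t′ k < b (suc k)
      t′-< k with t k <? b (suc k)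
      ... | yes t<b = t<b
      ... | no  _   = ≤-<-trans z≤n (b-inc k)
      t′≡t : ∀ k → t k < b (suc k) → t′ k ≡ t k
      t′≡t k t<b with t k <? b (suc k)
      ... | yes _   = refl
      ... | no  t≮b = contradiction t<b t≮b

      run∈reach : ∀ {N} k → b k ≤ N → run t′ k ∈ reach N k
      run∈reach zero    _   = here refl
      run∈reach (suc k) b≤N = ∈-++⁺ʳ (reach _ k)
        (∈-cartesianProductWith⁺ act (run∈reach k (≤-trans (<⇒≤ (b-inc k)) b≤N))
                                     (∈-upTo⁺ (<-≤-trans (t′-< k) b≤N)))

      meets : ∀ i m → ∃[ k ] Goal i m (run t′ k)
      meets i m =
        let k , m≤k , hb<b , tk≡ = proj₂ guess i m
            k≤b = increasing⇒≥ {b} b-inc k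
            t<b = subst (_< b (suc k)) (sym tk≡) (<-trans (increasingHull-> (u i) (b k)) hb<b)
        in suc k , subst (λ a → Goal i m (act (run t′ k) a)) (sym (trans (t′≡t k t<b) tk≡))
             (proj₂ (universal i (b k)) (reach-mono (≤⇒≤′ k≤b) (run∈reach k ≤-refl)) (≤-trans m≤k k≤b))

  -- Trees of tuples

  module _ {R : Set} (code : Countable R) {n : ℕ} (ℕ↠Fin-n : ℕ ↠ Fin n) where

    relOf : ∀ {k} → ℕ → Formula R n k
    relOf m with decide (∃[ r ] Injection.to code r ≡ m)
    ... | yes (r , _) = rel r
    ... | no  _       = ⊥′

    relOf-surjective : ∀ {k} r → ∃[ m ] relOf {k} m ≡ rel r
    relOf-surjective {k} r = _ , relOf-code
      where
      relOf-code : relOf {k} (Injection.to code r) ≡ rel r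
      relOf-code with decide (∃[ r′ ] Injection.to code r′ ≡ Injection.to code r)
      ... | yes (r′ , e) = cong rel (Injection.injective code e)
      ... | no  ∄        = contradiction (r , refl) ∄

    withTuple : ∀ {k} → Formula R n k → Vec (Fin n) n → Formula R n k
    withTuple {G} (rel r) τ = relAt r τ
    withTuple     φ       τ = φ

    node : ∀ {k} → (ℕ → Formula R n k) → ℕ × ℕ × ℕ → Formula R n k
    node rec (0 , x , y) = relOf x
    node rec (1 , x , y) = withTuple (relOf x) (to (ℕ↠Vec ℕ↠Fin-n n) y)
    node rec (2 , x , y) = eq (to ℕ↠Fin-n x) (to ℕ↠Fin-n y)
    node rec (3 , x , y) = rec x ∧′ rec y
    node rec (4 , x , y) = rec x ∨′ rec y
    node rec (5 , x , y) = rec x ⇒′ rec y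
    node rec (6 , x , y) = ∃′ (to ℕ↠Fin-n x) (rec y)
    node rec _           = ⊥′

    ℕ↠ℕ³ : ℕ ↠ (ℕ × ℕ × ℕ)
    ℕ↠ℕ³ = ℕ↠× (↠-id ℕ) ℕ↠ℕ×ℕ

    decode : ∀ {k} → ℕ → ℕ → Formula R n k
    decode zero    m = ⊥′
    decode (suc d) m = node (decode d) (to ℕ↠ℕ³ m)

    Decodable : ∀ {k} → ℕ → Formula R n k → Set
    Decodable d φ = ∀ {e} → d ≤ e → ∃[ m ] decode e m ≡ φ

    decodable-node : ∀ {k d} {φ : Formula R n k} →
                     (∀ {e} → d ≤ e → ∃[ p ] node (decode e) p ≡ φ) → Decodable (suc d) φ
    decodable-node ∃p {suc e′} (s≤s d≤e) with p , e ← ∃p d≤e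
      = to⁻ ℕ↠ℕ³ p , trans (cong (node (decode e′)) (to∘to⁻ ℕ↠ℕ³ p)) e

    decodable₂ : ∀ {k d d′} {φ ψ : Formula R n k} (_⊙_ : Formula R n k → Formula R n k → Formula R n k) tag →
                 (∀ rec x y → node rec (tag , x , y) ≡ rec x ⊙ rec y) →
                 Decodable d φ → Decodable d′ ψ → Decodable (suc (d ⊔ d′)) (φ ⊙ ψ)
    decodable₂ {d = d} {d′} _⊙_ tag node≡ ∃φ ∃ψ = decodable-node λ d≤e →
      let x , e₁ = ∃φ (≤-trans (m≤m⊔n d d′) d≤e)
          y , e₂ = ∃ψ (≤-trans (m≤n⊔m d d′) d≤e)
      in (tag , x , y) , trans (node≡ _ x y) (cong₂ _⊙_ e₁ e₂)

    decodable : ∀ {k} (φ : Formula R n k) → ∃[ d ] Decodable d φ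
    decodable (rel r) with x , e ← relOf-surjective r = 1 , decodable-node λ _ → (0 , x , 0) , e
    decodable (relAt r τ) with x , e ← relOf-surjective {G} r = 1 , decodable-node λ _ →
      (1 , x , to⁻ (ℕ↠Vec ℕ↠Fin-n n) τ) , cong₂ withTuple e (to∘to⁻ (ℕ↠Vec ℕ↠Fin-n n) τ)
    decodable (eq i j) = 1 , decodable-node λ _ →
      (2 , to⁻ ℕ↠Fin-n i , to⁻ ℕ↠Fin-n j) , cong₂ eq (to∘to⁻ ℕ↠Fin-n i) (to∘to⁻ ℕ↠Fin-n j)
    decodable ⊥′ = 0 , λ { {zero} _ → 0 , refl ; {suc e} _ → to⁻ ℕ↠ℕ³ (7 , 0 , 0) ,
      cong (node (decode e)) (to∘to⁻ ℕ↠ℕ³ (7 , 0 , 0)) }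
    decodable (φ ∧′ ψ) = _ , decodable₂ _∧′_ 3 (λ _ _ _ → refl) (proj₂ (decodable φ)) (proj₂ (decodable ψ))
    decodable (φ ∨′ ψ) = _ , decodable₂ _∨′_ 4 (λ _ _ _ → refl) (proj₂ (decodable φ)) (proj₂ (decodable ψ))
    decodable (φ ⇒′ ψ) = _ , decodable₂ _⇒′_ 5 (λ _ _ _ → refl) (proj₂ (decodable φ)) (proj₂ (decodable ψ))
    decodable (∃′ i φ) = _ , decodable-node λ d≤e →
      let y , e = proj₂ (decodable φ) d≤e
      in (6 , to⁻ ℕ↠Fin-n i , y) , cong₂ ∃′ (to∘to⁻ ℕ↠Fin-n i) e

    abstract
      ℕ↠Formula : ∀ k → ℕ ↠ Formula R n k
      ℕ↠Formula k = mk↠ₛ surjective ↠-∘ ℕ↠ℕ×ℕ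
        where
        surjective : ∀ φ → ∃[ p ] decode {k} (proj₁ p) (proj₂ p) ≡ φ
        surjective φ = let d , ∃m = decodable φ
                           m , e  = ∃m ≤-refl
                       in (d , m) , e

      ℕ↠Key : ∀ k → ℕ ↠ Key R n k
      ℕ↠Key D = mk↠ₛ surjective ↠-∘ ℕ↠× ℕ↠Fin-n (ℕ↠Formula D)
        where
        surjective : (κ : Key R n D) → ∃[ p ] wit {k = D} (proj₁ p) (proj₂ p) ≡ κ
        surjective (wit i φ) = (i , φ) , refl
      ℕ↠Key G = mk↠ₛ surjective ↠-∘ ℕ↠⊎ (ℕ↠× ℕ↠Fin-n (ℕ↠Formula G)) (ℕ↠× ℕ↠Fin-n ℕ↠Fin-n)
        where
        key : (Fin n × Formula R n G) ⊎ (Fin n × Fin n) → Key R n G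
        key (inj₁ (i , φ)) = wit i φ
        key (inj₂ (i , j)) = swap i j
        surjective : (κ : Key R n G) → ∃[ p ] key p ≡ κ
        surjective (wit i φ)  = inj₁ (i , φ) , refl
        surjective (swap i j) = inj₂ (i , j) , refl

  module Trees {R : Set} {n : ℕ} {k : Kind} where

    Node : Set
    Node = List (Key R n k)

    Entry : Set
    Entry = Node × Formula R n k

    module _ (𝔐 : Model R n k) where
      open Model 𝔐 using (Base; V; isUnit)

      AgreeOff : Fin n → Vec Base n → Vec Base n → Set
      AgreeOff i t s = ∀ j → j ≢ i → lookup t j ≡ lookup s j

      Edge : Key R n k → Vec Base n → Vec Base n → Set
      Edge (wit i ψ)  s t = AgreeOff i t s × (Sat 𝔐 s (∃′ i ψ) → Sat 𝔐 t ψ)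
      Edge (swap i j) s t = t ≡ s ∘ᵥ transposition i j

      record Coherent (f : Node → Vec Base n) : Set where
        field
          unit : ∀ ν → V (f ν)
          edge : ∀ ν κ → Edge κ (f ν) (f (ν ∷ʳ κ))

      Satisfies : (Node → Vec Base n) → List Entry → Set
      Satisfies f c = ∀ {ν φ} → (ν , φ) ∈ c → Sat 𝔐 (f ν) φ

      ∃-cong : ∀ i φ {s t} → AgreeOff i s t → Sat 𝔐 s (∃′ i φ) → Sat 𝔐 t (∃′ i φ)
      ∃-cong _ _ s≈t (u , u∈ , u≈s , p) = u , u∈ , (λ j j≢i → trans (u≈s j j≢i) (s≈t j j≢i)) , p

      successor : ∀ κ {s} → V s → ∃[ t ] V t × Edge κ s t
      successor (wit i ψ) {s} s∈ with decide (Sat 𝔐 s (∃′ i ψ))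
      ... | yes (t , t∈ , t≈s , p) = t , t∈ , t≈s , λ _ → p
      ... | no  ∄                  = s , s∈ , (λ _ _ → refl) , ⊥-elim ∘ ∄
      successor (swap i j) {s} s∈  = _ , isUnit s s∈ (transposition i j) , refl

    forth : Key R n k → Formula R n k → Formula R n k
    forth (wit i ψ)  φ = ∃′ i ((∃′ i ψ ⇒′ ψ) ∧′ φ)
    forth (swap i j) φ = permute (transpose i j) φ

    back : Key R n k → Formula R n k → Formula R n k
    back (wit i ψ)  φ = (∃′ i ψ ⇒′ ψ) ∧′ ∃′ i φ
    back (swap i j) φ = permute (transpose i j) φ

    module _ (𝔐 : Model R n k) where
      open Model 𝔐 using (Base; V; isUnit)

      sym-AgreeOff : ∀ {i} s t → AgreeOff 𝔐 i s t → AgreeOff 𝔐 i t s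
      sym-AgreeOff _ _ s≈t j j≢i = sym (s≈t j j≢i)

      forth⁺ : ∀ κ {s t φ} → Edge 𝔐 κ s t → V t → Sat 𝔐 t φ → Sat 𝔐 s (forth κ φ)
      forth⁺ (wit i ψ) {s} {t} (t≈s , p) t∈ q = t , t∈ , t≈s , (λ r → p (∃-cong 𝔐 i ψ {t} {s} t≈s r)) , q
      forth⁺ (swap i j) {φ = φ} refl t∈ q = permute⁺ 𝔐 _ (transpose-involutive i j) φ q

      forth⁻ : ∀ κ {s φ} → V s → Sat 𝔐 s (forth κ φ) → ∃[ t ] V t × Edge 𝔐 κ s t × Sat 𝔐 t φ
      forth⁻ (wit i ψ) {s} s∈ (t , t∈ , t≈s , p , q) =
        t , t∈ , (t≈s , λ r → p (∃-cong 𝔐 i ψ {s} {t} (sym-AgreeOff t s t≈s) r)) , q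
      forth⁻ (swap i j) {s} {φ} s∈ q =
        _ , isUnit s s∈ (transposition i j) , refl , permute⁻ 𝔐 _ (transpose-involutive i j) φ q

      back⁺ : ∀ κ {s t φ} → Edge 𝔐 κ s t → V s → Sat 𝔐 s φ → Sat 𝔐 t (back κ φ)
      back⁺ (wit i ψ) {s} {t} (t≈s , p) s∈ q =
        (λ r → p (∃-cong 𝔐 i ψ {t} {s} t≈s r)) , s , s∈ , sym-AgreeOff t s t≈s , q
      back⁺ (swap i j) {s} {φ = φ} refl s∈ q = permute⁺ 𝔐 _ inv φ
        (subst (λ s → Sat 𝔐 s φ) (sym (∘f-involutive 𝔐 _ inv s)) q)
        where inv = transpose-involutive i j

      back⁻ : ∀ κ {t φ} → V t → Sat 𝔐 t (back κ φ) → ∃[ s ] V s × Edge 𝔐 κ s t × Sat 𝔐 s φ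
      back⁻ (wit i ψ) {t} t∈ (p , s , s∈ , s≈t , q) =
        s , s∈ , (sym-AgreeOff s t s≈t , λ r → p (∃-cong 𝔐 i ψ {s} {t} s≈t r)) , q
      back⁻ (swap i j) {t} {φ} t∈ q =
        _ , isUnit t t∈ (transposition i j) , sym (∘f-involutive 𝔐 _ inv t) , permute⁻ 𝔐 _ inv φ q
        where inv = transpose-involutive i j

      Rooted : (κ : Key R n k) (s : Vec Base n) (c : List Entry) → Set
      Rooted κ s c = Σ[ f ∈ (Node → Vec Base n) ] Coherent 𝔐 f × Edge 𝔐 κ s (f []) × Satisfies 𝔐 f c

      graft : Vec Base n → (Key R n k → Node → Vec Base n) → Node → Vec Base n
      graft s f []      = s
      graft s f (κ ∷ ν) = f κ ν

      graft-coherent : ∀ {s f} → V s → (∀ κ → Coherent 𝔐 (f κ)) → (∀ κ → Edge 𝔐 κ s (f κ [])) →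
                       Coherent 𝔐 (graft s f)
      graft-coherent {s} {f} s∈ coh e = record { unit = unit ; edge = edge }
        where
        unit : ∀ ν → V (graft s f ν)
        unit []      = s∈
        unit (κ ∷ ν) = Coherent.unit (coh κ) ν
        edge : ∀ ν κ → Edge 𝔐 κ (graft s f ν) (graft s f (ν ∷ʳ κ))
        edge []      κ = e κ
        edge (κ ∷ ν) κ′ = Coherent.edge (coh κ) ν κ′

      branch-coherent : ∀ {f} → Coherent 𝔐 f → ∀ κ → Coherent 𝔐 (f ∘ (κ ∷_))
      branch-coherent coh κ = record
        { unit = Coherent.unit coh ∘ (κ ∷_) ; edge = Coherent.edge coh ∘ (κ ∷_) }

      grown : ∀ {s} → V s → Node → ∃[ t ] V t
      grown {s} s∈ []      = s , s∈
      grown     s∈ (κ ∷ ν) = let _ , t∈ , _ = successor 𝔐 κ s∈ in grown t∈ ν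

      grown-edge : ∀ {s} (s∈ : V s) ν κ → Edge 𝔐 κ (proj₁ (grown s∈ ν)) (proj₁ (grown s∈ (ν ∷ʳ κ)))
      grown-edge s∈ []       κ = proj₂ (proj₂ (successor 𝔐 κ s∈))
      grown-edge s∈ (κ₀ ∷ ν) κ = grown-edge (proj₁ (proj₂ (successor 𝔐 κ₀ s∈))) ν κ

      grown-coherent : ∀ {s} (s∈ : V s) → Coherent 𝔐 (proj₁ ∘ grown s∈)
      grown-coherent s∈ = record { unit = proj₂ ∘ grown s∈ ; edge = grown-edge s∈ }

    conj : List (Formula R n k) → Formula R n k
    conj []       = ¬′ ⊥′
    conj (φ ∷ φs) = φ ∧′ conj φs

    conj⁺ : ∀ 𝔐 {s} φs → (∀ {φ} → φ ∈ φs → Sat 𝔐 s φ) → Sat 𝔐 s (conj φs)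
    conj⁺ 𝔐 []       p = id
    conj⁺ 𝔐 (φ ∷ φs) p = p (here refl) , conj⁺ 𝔐 φs (p ∘ there)

    conj⁻ : ∀ 𝔐 {s} φs → Sat 𝔐 s (conj φs) → ∀ {φ} → φ ∈ φs → Sat 𝔐 s φ
    conj⁻ 𝔐 (φ ∷ φs) (p , q) (here refl) = p
    conj⁻ 𝔐 (φ ∷ φs) (p , q) (there φ∈)  = conj⁻ 𝔐 φs q φ∈

    below : Key R n k → List Entry → List Entry
    below κ []                 = []
    below κ (([] , φ) ∷ c)     = below κ c
    below κ ((κ′ ∷ ν , φ) ∷ c) with decide (κ ≡ κ′)
    ... | yes _ = (ν , φ) ∷ below κ c
    ... | no  _ = below κ c

    below⁺ : ∀ {κ ν φ} c → (κ ∷ ν , φ) ∈ c → (ν , φ) ∈ below κ c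
    below⁺         (([] , _) ∷ c)     (there e∈)  = below⁺ c e∈
    below⁺ {κ}     ((κ′ ∷ ν , φ) ∷ c) e∈          with decide (κ ≡ κ′)
    below⁺         (_ ∷ c)            (here refl) | yes _   = here refl
    below⁺         (_ ∷ c)            (there e∈)  | yes _   = there (below⁺ c e∈)
    below⁺         (_ ∷ c)            (here refl) | no  κ≢κ = contradiction refl κ≢κ
    below⁺         (_ ∷ c)            (there e∈)  | no  _   = below⁺ c e∈

    below⁻ : ∀ {κ ν φ} c → (ν , φ) ∈ below κ c → (κ ∷ ν , φ) ∈ c
    below⁻     (([] , _) ∷ c)     e∈          = there (below⁻ c e∈)
    below⁻ {κ} ((κ′ ∷ ν , φ) ∷ c) e∈          with decide (κ ≡ κ′)
    below⁻     (_ ∷ c)            (here refl) | yes refl = here refl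
    below⁻     (_ ∷ c)            (there e∈)  | yes _    = there (below⁻ c e∈)
    below⁻     (_ ∷ c)            e∈          | no  _    = there (below⁻ c e∈)

    rootFormula : ℕ → List Entry → Formula R n k
    rootPart    : ℕ → List Entry → Entry → Formula R n k
    rootFormula d c = conj (List.map (rootPart d c) c)
    rootPart d       c ([]    , φ) = φ
    rootPart zero    c (κ ∷ ν , φ) = ¬′ ⊥′
    rootPart (suc d) c (κ ∷ ν , φ) = forth κ (rootFormula d (below κ c))

    Depth≤ : ℕ → List Entry → Set
    Depth≤ d c = ∀ {ν φ} → (ν , φ) ∈ c → length ν ≤ d

    depth : ∀ c → ∃[ d ] Depth≤ d c
    depth []            = 0 , λ ()
    depth ((ν , φ) ∷ c) with d , ≤d ← depth c = length ν ⊔ d , λ where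
      (here refl) → m≤m⊔n (length ν) d
      (there e∈)  → ≤-trans (≤d e∈) (m≤n⊔m (length ν) d)

    module _ (𝔐 : Model R n k) where
      open Model 𝔐 using (Base; V; isUnit)

      rootFormula⁺ : ∀ d c {f} → Coherent 𝔐 f → Satisfies 𝔐 f c → Sat 𝔐 (f []) (rootFormula d c)
      rootFormula⁺ d c {f} coh sat = conj⁺ 𝔐 (List.map (rootPart d c) c) λ φ∈ →
        let e , e∈ , φ≡ = ∈-map⁻ (rootPart d c) φ∈
        in subst (Sat 𝔐 (f [])) (sym φ≡) (part d e e∈)
        where
        part : ∀ d e → e ∈ c → Sat 𝔐 (f []) (rootPart d c e)
        part d       ([]    , φ) e∈ = sat e∈
        part zero    (κ ∷ ν , φ) e∈ = id
        part (suc d) (κ ∷ ν , φ) e∈ = forth⁺ 𝔐 κ (Coherent.edge coh [] κ) (Coherent.unit coh (κ ∷ []))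
          (rootFormula⁺ d (below κ c) (branch-coherent 𝔐 coh κ) (sat ∘ below⁻ c))

      rootFormula⁻ : ∀ d c → Depth≤ d c → ∀ {s} → V s → Sat 𝔐 s (rootFormula d c) →
                     Σ[ f ∈ (Node → Vec Base n) ] Coherent 𝔐 f × f [] ≡ s × Satisfies 𝔐 f c
      rootFormula⁻ d c ≤d {s} s∈ p =
        graft 𝔐 s (proj₁ ∘ branch) ,
        graft-coherent 𝔐 s∈ (proj₁ ∘ proj₂ ∘ branch) (proj₁ ∘ proj₂ ∘ proj₂ ∘ branch) ,
        refl , λ {ν} → sat ν
        where
        parts : ∀ {e} → e ∈ c → Sat 𝔐 s (rootPart d c e)
        parts e∈ = conj⁻ 𝔐 (List.map (rootPart d c) c) p (∈-map⁺ (rootPart d c) e∈)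
        inhabited-branch : ∀ d κ {ν φ} → length (κ ∷ ν) ≤ d → Depth≤ d c →
                           Sat 𝔐 s (rootPart d c (κ ∷ ν , φ)) → Rooted 𝔐 κ s (below κ c)
        inhabited-branch (suc d) κ _ ≤d q =
          let t , t∈ , e , r       = forth⁻ 𝔐 κ s∈ q
              f , coh , f[]≡t , sat = rootFormula⁻ d (below κ c) (≤-pred ∘ ≤d ∘ below⁻ c) t∈ r
          in f , coh , subst (Edge 𝔐 κ s) (sym f[]≡t) e , sat
        branch : ∀ κ → Rooted 𝔐 κ s (below κ c)
        branch κ with decide (∃[ e ] (κ ∷ proj₁ e , proj₂ e) ∈ c)
        ... | yes (_ , e∈) = inhabited-branch d κ (≤d e∈) ≤d (parts e∈)
        ... | no  ∄e       =
          let t , t∈ , e = successor 𝔐 κ s∈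
          in proj₁ ∘ grown 𝔐 t∈ , grown-coherent 𝔐 t∈ , e , λ e∈ → contradiction (_ , below⁻ c e∈) ∄e
        sat : ∀ ν {φ} → (ν , φ) ∈ c → Sat 𝔐 (graft 𝔐 s (proj₁ ∘ branch) ν) φ
        sat []      e∈ = parts e∈
        sat (κ ∷ ν) e∈ = proj₂ (proj₂ (proj₂ (branch κ))) (below⁺ c e∈)

  -- Generic trees

  module Omission {R : Set} {n : ℕ} {k : Kind} (T : Pred (Formula R n k) 0ℓ) where
    open Trees {R} {n} {k}

    record Interpretation : Set₁ where
      field
        model    : Model R n k
        models   : IsModelOf model T
        value    : Node → Vec (Model.Base model) n
        coherent : Coherent model value
      open Coherent coherent public

    open Interpretation

    infix 4 _⊩_
    _⊩_ : Interpretation → Entry → Set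
    ρ ⊩ (ν , φ) = Sat (model ρ) (value ρ ν) φ

    Realizer : List Entry → Set₁
    Realizer c = Σ[ ρ ∈ Interpretation ] (∀ {e} → e ∈ c → ρ ⊩ e)

    add : ∀ {c e} (r : Realizer c) → proj₁ r ⊩ e → Realizer (e ∷ c)
    add (ρ , sat) p = ρ , λ { (here refl) → p ; (there e∈) → sat e∈ }

    rooted : ∀ 𝔐 → IsModelOf 𝔐 T → ∀ {s} → Model.V 𝔐 s → Realizer []
    rooted 𝔐 ⊨T s∈ = record
      { model = 𝔐 ; models = ⊨T ; value = proj₁ ∘ grown 𝔐 s∈ ; coherent = grown-coherent 𝔐 s∈ } , λ ()

    consistent⇒realizer : Consistent T → Realizer []
    consistent⇒realizer con = byContradiction λ ∄r → con λ 𝔐 ⊨T s s∈ → ∄r (rooted 𝔐 ⊨T s∈)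

    omitAtRoot : ∀ {Γ} → NonPrincipal T Γ → ∀ 𝔐 → IsModelOf 𝔐 T → ∀ {s} → Model.V 𝔐 s →
                 ∀ ψ → Sat 𝔐 s ψ →
                 ∃[ γ ] Γ γ × Σ[ 𝔐′ ∈ Model R n k ] IsModelOf 𝔐′ T ×
                 ∃[ s ] Model.V 𝔐′ s × Sat 𝔐′ s ψ × ¬ Sat 𝔐′ s γ
    omitAtRoot nonprincipal 𝔐 ⊨T s∈ ψ p = byContradiction λ ∄ → nonprincipal
      ( ψ , (λ ⊨¬ψ → ⊨¬ψ 𝔐 ⊨T _ s∈ p)
      , λ γ γ∈ 𝔐′ ⊨T′ t t∈ q → byContradiction λ ¬r → ∄ (γ , γ∈ , 𝔐′ , ⊨T′ , t , t∈ , q , ¬r) )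

    -- The induction moves the root along ν: what the rest of the tree demands
    -- of the new root is kept in the formula θ.
    omit : ∀ {Γ} → NonPrincipal T Γ → ∀ ν θ c (r : Realizer c) → proj₁ r ⊩ ([] , θ) →
           ∃[ γ ] Γ γ × Σ[ r′ ∈ Realizer c ] proj₁ r′ ⊩ ([] , θ) × ¬ proj₁ r′ ⊩ (ν , γ)
    omit nonprincipal [] θ c (ρ , sat) p =
      let d , ≤d = depth c
          γ , γ∈ , 𝔐 , ⊨T , s , s∈ , (p′ , q) , ¬r =
            omitAtRoot nonprincipal (model ρ) (models ρ) (unit ρ []) (θ ∧′ rootFormula d c)
              (p , rootFormula⁺ (model ρ) d c (coherent ρ) sat)
          f , coh , f[]≡s , sat′ = rootFormula⁻ 𝔐 d c ≤d s∈ q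
      in γ , γ∈ ,
         (record { model = 𝔐 ; models = ⊨T ; value = f ; coherent = coh } , sat′) ,
         subst (λ s → Sat 𝔐 s θ) (sym f[]≡s) p′ ,
         ¬r ∘ subst (λ s → Sat 𝔐 s γ) f[]≡s
    omit nonprincipal (κ ∷ ν) θ c (ρ , sat) p =
      let d , ≤d = depth c
          ψ      = θ ∧′ rootFormula d c
          branch = record { model = model ρ ; models = models ρ ; value = value ρ ∘ (κ ∷_)
                          ; coherent = branch-coherent (model ρ) (coherent ρ) κ }
          γ , γ∈ , (ρ₁ , sat₁) , q , ¬r =
            omit nonprincipal ν (back κ ψ) (below κ c) (branch , sat ∘ below⁻ c)
              (back⁺ (model ρ) κ {φ = ψ} (edge ρ [] κ) (unit ρ [])
                (p , rootFormula⁺ (model ρ) d c (coherent ρ) sat))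
          s , s∈ , e , p′ , q′ = back⁻ (model ρ₁) κ {φ = ψ} (unit ρ₁ []) q
          f , coh , f[]≡s , sat₂ = rootFormula⁻ (model ρ₁) d c ≤d s∈ q′
          g      = replace f (value ρ₁)
      in γ , γ∈ ,
         ( record { model = model ρ₁ ; models = models ρ₁ ; value = graft (model ρ₁) s g
                  ; coherent = graft-coherent (model ρ₁) s∈
                      (replace-coherent (model ρ₁) coh (coherent ρ₁))
                      (replace-edge (model ρ₁) (subst (λ s → ∀ κ → Edge (model ρ₁) κ s (f (κ ∷ []))) f[]≡s (Coherent.edge coh [])) e) }
         , λ {e} → replace-satisfies (model ρ₁) f[]≡s sat₂ sat₁ {e} ) ,
         p′ ,
         ¬r ∘ subst (λ h → Sat (model ρ₁) (h ν) γ) (replace-at f (value ρ₁))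
      where
      replace : ∀ {M : Set} → (Node → Vec M n) → (Node → Vec M n) → Key R n k → Node → Vec M n
      replace f f′ κ′ with decide (κ ≡ κ′)
      ... | yes _ = f′
      ... | no  _ = f ∘ (κ′ ∷_)
      replace-at : ∀ {M : Set} (f f′ : Node → Vec M n) → replace f f′ κ ≡ f′
      replace-at f f′ with decide (κ ≡ κ)
      ... | yes _   = refl
      ... | no  κ≢κ = contradiction refl κ≢κ
      replace-coherent : ∀ 𝔐 {f f′} → Coherent 𝔐 f → Coherent 𝔐 f′ → ∀ κ′ → Coherent 𝔐 (replace f f′ κ′)
      replace-coherent 𝔐 coh coh′ κ′ with decide (κ ≡ κ′)
      ... | yes _ = coh′
      ... | no  _ = branch-coherent 𝔐 coh κ′
      replace-edge : ∀ 𝔐 {f f′ s} → (∀ κ → Edge 𝔐 κ s (f (κ ∷ []))) → Edge 𝔐 κ s (f′ []) →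
                     ∀ κ′ → Edge 𝔐 κ′ s (replace f f′ κ′ [])
      replace-edge 𝔐 e e′ κ′ with decide (κ ≡ κ′)
      ... | yes refl = e′
      ... | no  _    = e κ′
      replace-satisfies : ∀ 𝔐 {f f′ s} → f [] ≡ s → Satisfies 𝔐 f c → Satisfies 𝔐 f′ (below κ c) →
                          ∀ {e} → e ∈ c → Sat 𝔐 (graft 𝔐 s (replace f f′) (proj₁ e)) (proj₂ e)
      replace-satisfies 𝔐 refl sat sat′ {[] , φ}     e∈ = sat e∈
      replace-satisfies 𝔐 refl sat sat′ {κ′ ∷ ν , φ} e∈ with decide (κ ≡ κ′)
      ... | yes refl = sat′ (below⁺ c e∈)
      ... | no  _    = sat e∈

    State : Set₁
    State = ∃[ c ] Realizer c

    Extends : State → State → Set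
    Extends s s′ = ∀ {e} → e ∈ proj₁ s → e ∈ proj₁ s′

    step : State → Entry → State
    step (c , r) e with decide (Realizer (e ∷ c))
    ... | yes r′ = e ∷ c , r′
    ... | no  _  = c , r

    step-extends : ∀ s e → Extends s (step s e)
    step-extends (c , r) e e∈ with decide (Realizer (e ∷ c))
    ... | yes _ = there e∈
    ... | no  _ = e∈

    step-∈ : ∀ s {e} → Realizer (e ∷ proj₁ s) → e ∈ proj₁ (step s e)
    step-∈ (c , _) {e} r with decide (Realizer (e ∷ c))
    ... | yes _ = here refl
    ... | no  ∄ = contradiction r ∄

    steps-extend : ∀ s es → Extends s (foldl step s es)
    steps-extend s []       e∈ = e∈
    steps-extend s (e ∷ es) e∈ = steps-extend (step s e) es (step-extends s e e∈)

    Decided : List Entry → Entry → Set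
    Decided c (ν , φ) = (ν , φ) ∈ c ⊎ (ν , ¬′ φ) ∈ c

    OmittedAt : List Entry → Node → Pred (Formula R n k) 0ℓ → Set
    OmittedAt c ν Γ = ∃[ γ ] Γ γ × (ν , ¬′ γ) ∈ c

    decidedStep : ∀ s e → ∃[ e′ ] Decided (proj₁ (step s e′)) e
    decidedStep s@(_ , r) (ν , φ) with decide (proj₁ r ⊩ (ν , φ))
    ... | yes p = (ν , φ)    , inj₁ (step-∈ s (add r p))
    ... | no ¬p = (ν , ¬′ φ) , inj₂ (step-∈ s (add r ¬p))

    omittedStep : ∀ {Γ} → NonPrincipal T Γ → ∀ s ν → ∃[ e ] OmittedAt (proj₁ (step s e)) ν Γ
    omittedStep nonprincipal s@(c , r) ν =
      let γ , γ∈ , r′ , _ , ¬p = omit nonprincipal ν (¬′ ⊥′) c r id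
      in (ν , ¬′ γ) , γ , γ∈ , step-∈ s (add r′ ¬p)

    record GenericChain {I : Set} (Γ : I → Pred (Formula R n k) 0ℓ) : Set₁ where
      field
        chain    : ℕ → State
        grows    : ∀ m → Extends (chain m) (chain (suc m))
        complete : ∀ e → ∃[ m ] Decided (proj₁ (chain m)) e
        omits    : ∀ i ν → ∃[ m ] OmittedAt (proj₁ (chain m)) ν (Γ i)

    genericChain : ℕ ↠ Key R n k → ℕ ↠ Formula R n k → Consistent T →
                   ∀ {I} → I → Guessable I →
                   (Γ : I → Pred (Formula R n k) 0ℓ) → (∀ i → NonPrincipal T (Γ i)) →
                   GenericChain Γ
    genericChain ℕ↠Key ℕ↠Formula con {I} i₀ guessable Γ nonprincipal = record
      { chain    = run t
      ; grows    = λ m → steps-extend (run t m) (to ℕ↠Entries (t m))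
      ; complete = λ e → let m , d , _ = met i₀ e in m , d
      ; omits    = λ i ν → let m , _ , o = met i (ν , ⊥′) in m , o
      }
      where
      ℕ↠Entry : ℕ ↠ Entry
      ℕ↠Entry = ℕ↠× (ℕ↠List ℕ↠Key) ℕ↠Formula
      ℕ↠Entries : ℕ ↠ List Entry
      ℕ↠Entries = ℕ↠List ℕ↠Entry
      act : State → ℕ → State
      act s a = foldl step s (to ℕ↠Entries a)
      act-to⁻ : ∀ s es → act s (to⁻ ℕ↠Entries es) ≡ foldl step s es
      act-to⁻ s es = cong (foldl step s) (to∘to⁻ ℕ↠Entries es)
      compose : ∀ a b → ∃[ c ] ∀ s → act s c ≡ act (act s a) b
      compose a b = to⁻ ℕ↠Entries (to ℕ↠Entries a ++ to ℕ↠Entries b) , λ s →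
        trans (act-to⁻ s _) (foldl-++ step s (to ℕ↠Entries a) (to ℕ↠Entries b))
      Goal : I → Entry → State → Set
      Goal i e (c , _) = Decided c e × OmittedAt c (proj₁ e) (Γ i)
      Goal-mono : ∀ i e s s′ → Extends s s′ → Goal i e s → Goal i e s′
      Goal-mono i e s s′ ⊆ (d , γ , γ∈ , e∈) = Sum.map ⊆ ⊆ d , γ , γ∈ , ⊆ e∈
      dense : ∀ i e s → ∃[ a ] Goal i e (act s a)
      dense i e s =
        let e₁ , d = decidedStep s e
            e₂ , o = omittedStep (nonprincipal i) (step s e₁) (proj₁ e)
            ⊆      = step-extends (step s e₁) e₂
        in to⁻ ℕ↠Entries (e₁ ∷ e₂ ∷ []) ,
           subst (Goal i e) (sym (act-to⁻ s (e₁ ∷ e₂ ∷ []))) (Sum.map ⊆ ⊆ d , o)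
      open Generic ([] , consistent⇒realizer con) act compose (λ i m → Goal i (to ℕ↠Entry m))
        (λ {i} {m} {s} a → Goal-mono i (to ℕ↠Entry m) s (act s a) (steps-extend s (to ℕ↠Entries a)))
        (λ i m → dense i (to ℕ↠Entry m))
      t : ℕ → ℕ
      t = proj₁ (generic guessable)
      met : ∀ i e → ∃[ m ] Goal i e (run t m)
      met i e = let m , g = proj₂ (generic guessable) i (to⁻ ℕ↠Entry e)
                in m , subst (λ e → Goal i e (run t m)) (to∘to⁻ ℕ↠Entry e) g

  least : ∀ {ℓ} (P : ℕ → Set ℓ) → ∃[ m ] P m → ∃[ m ] P m × (∀ l → P l → m ≤ l)
  least P (b , pb) with search (suc b)
    where
    search : ∀ b → (∀ l → l < b → ¬ P l) ⊎ (∃[ m ] P m × (∀ l → P l → m ≤ l))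
    search zero    = inj₁ λ _ ()
    search (suc b) with search b
    ... | inj₂ found = inj₂ found
    ... | inj₁ none with decide (P b)
    ...   | yes pb = inj₂ (b , pb , λ l pl → ≮⇒≥ λ l<b → none l l<b pl)
    ...   | no ¬pb = inj₁ λ l l<1+b pl → none l (≤∧≢⇒< (≤-pred l<1+b) λ { refl → ¬pb pl }) pl
  ... | inj₁ none  = contradiction pb (none b ≤-refl)
  ... | inj₂ found = found

  -- A class is represented by the least index of its elements.
  module QuotientBy {E : Set} (ℕ↠E : ℕ ↠ E) {ℓ : Level} (_~_ : E → E → Set ℓ)
           (~-refl : ∀ {x} → x ~ x) (~-sym : ∀ {x y} → x ~ y → y ~ x)
           (~-trans : ∀ {x y z} → x ~ y → y ~ z → x ~ z) where

    abstract
      leastIndex : ∀ x → ∃[ m ] x ~ to ℕ↠E m × (∀ l → x ~ to ℕ↠E l → m ≤ l)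
      leastIndex x = least (λ m → x ~ to ℕ↠E m)
        (to⁻ ℕ↠E x , subst (x ~_) (sym (to∘to⁻ ℕ↠E x)) ~-refl)

    classIndex : E → ℕ
    classIndex x = proj₁ (leastIndex x)

    Quotient : Set
    Quotient = Σ[ m ∈ ℕ ] True (decide (∃[ x ] classIndex x ≡ m))

    class : E → Quotient
    class x = classIndex x , fromWitness (x , refl)

    Quotient-≡ : ∀ {q r : Quotient} → proj₁ q ≡ proj₁ r → q ≡ r
    Quotient-≡ {m , p} {_ , p′} refl = cong (m ,_) (T-irrelevant p p′)

    class-surjective : ∀ q → ∃[ x ] class x ≡ q
    class-surjective (m , p) with x , e ← toWitness p = x , Quotient-≡ e

    class-cong : ∀ {x y} → x ~ y → class x ≡ class y
    class-cong {x} {y} x~y = Quotient-≡ (≤-antisym (index≤ x~y) (index≤ (~-sym x~y)))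
      where
      index≤ : ∀ {x y} → x ~ y → classIndex x ≤ classIndex y
      index≤ {x} {y} x~y = proj₂ (proj₂ (leastIndex x)) _ (~-trans x~y (proj₁ (proj₂ (leastIndex y))))

    class-injective : ∀ {x y} → class x ≡ class y → x ~ y
    class-injective {x} {y} e = ~-trans (proj₁ (proj₂ (leastIndex x)))
      (~-sym (subst (λ m → y ~ to ℕ↠E m) (sym (cong proj₁ e)) (proj₁ (proj₂ (leastIndex y)))))

    Quotient-countable : Countable Quotient
    Quotient-countable = mk↣ {to = proj₁} Quotient-≡

  -- The model of a generic tree

  module GenericModel {R : Set} {n : ℕ} {k : Kind} (T : Pred (Formula R n k) 0ℓ)
                      {I : Set} {Γ : I → Pred (Formula R n k) 0ℓ} (generic : Omission.GenericChain T Γ)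
                      (ℕ↠Keys : ℕ ↠ Key R n k) (ℕ↠Fin-n : ℕ ↠ Fin n) where
    open Trees {R} {n} {k}
    open Omission T
    open Interpretation
    open GenericChain generic

    entries : ℕ → List Entry
    entries m = proj₁ (chain m)

    entries-mono : ∀ {l m} → l ≤′ m → ∀ {e} → e ∈ entries l → e ∈ entries m
    entries-mono ≤′-refl               e∈ = e∈
    entries-mono (≤′-step {n = m} l≤m) e∈ = grows m (entries-mono l≤m e∈)

    Forced : (Interpretation → Set) → Set₁
    Forced P = ∃[ m ] ∀ ((ρ , _) : Realizer (entries m)) → P ρ

    forced-map : ∀ {P Q} → (∀ ρ → P ρ → Q ρ) → Forced P → Forced Q
    forced-map f (m , p) = m , λ r → f (proj₁ r) (p r)

    forced-always : ∀ {P} → (∀ ρ → P ρ) → Forced P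
    forced-always p = 0 , λ (ρ , _) → p ρ

    forced-map₂ : ∀ {P Q S} → (∀ ρ → P ρ → Q ρ → S ρ) → Forced P → Forced Q → Forced S
    forced-map₂ f (l , p) (m , q) = l ⊔ m , λ (ρ , sat) →
      f ρ (p (ρ , λ e∈ → sat (entries-mono (≤⇒≤′ (m≤m⊔n l m)) e∈)))
          (q (ρ , λ e∈ → sat (entries-mono (≤⇒≤′ (m≤n⊔m l m)) e∈)))

    forced-∀ : ∀ {l} {P : Fin l → Interpretation → Set} →
               (∀ i → Forced (P i)) → Forced (λ ρ → ∀ i → P i ρ)
    forced-∀ {zero}  p = forced-always λ _ ()
    forced-∀ {suc l} p = forced-map₂ (λ { _ p₀ ps Fin.zero → p₀ ; _ p₀ ps (Fin.suc i) → ps i })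
                                     (p Fin.zero) (forced-∀ (p ∘ Fin.suc))

    ¬forced-⊥ : ¬ Forced (λ _ → ⊥)
    ¬forced-⊥ (m , p) = p (proj₂ (chain m))

    Enforced : Entry → Set
    Enforced e = ∃[ m ] e ∈ entries m

    enforced⇒forced : ∀ {e} → Enforced e → Forced (_⊩ e)
    enforced⇒forced (m , e∈) = m , λ (ρ , sat) → sat e∈

    enforced? : ∀ ν φ → Enforced (ν , φ) ⊎ Enforced (ν , ¬′ φ)
    enforced? ν φ with m , d ← complete (ν , φ) = Sum.map (m ,_) (m ,_) d

    forced⇒enforced : ∀ {ν φ} → Forced (_⊩ (ν , φ)) → Enforced (ν , φ)
    forced⇒enforced {ν} {φ} p with enforced? ν φ
    ... | inj₁ e  = e
    ... | inj₂ ¬e = ⊥-elim (¬forced-⊥ (forced-map₂ (λ _ p ¬p → ¬p p) p (enforced⇒forced ¬e)))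

    forced? : ∀ ν φ → Forced (_⊩ (ν , φ)) ⊎ Forced (_⊩ (ν , ¬′ φ))
    forced? ν φ = Sum.map enforced⇒forced enforced⇒forced (enforced? ν φ)

    Coordinate : Set
    Coordinate = Node × Fin n

    coordinate : ∀ ρ → Coordinate → Model.Base (model ρ)
    coordinate ρ (ν , j) = lookup (value ρ ν) j

    infix 4 _~_
    _~_ : Coordinate → Coordinate → Set₁
    x ~ y = Forced λ ρ → coordinate ρ x ≡ coordinate ρ y

    ℕ↠Coordinate : ℕ ↠ Coordinate
    ℕ↠Coordinate = ℕ↠× (ℕ↠List ℕ↠Keys) ℕ↠Fin-n

    ~-refl : ∀ {x} → x ~ x
    ~-refl = forced-always λ _ → refl

    ~-sym : ∀ {x y} → x ~ y → y ~ x
    ~-sym = forced-map λ _ → sym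

    ~-trans : ∀ {x y z} → x ~ y → y ~ z → x ~ z
    ~-trans = forced-map₂ λ _ → trans

    open QuotientBy ℕ↠Coordinate _~_ ~-refl ~-sym ~-trans

    tuple : Node → Vec Quotient n
    tuple ν = tabulate λ j → class (ν , j)

    lookup-tuple : ∀ ν j → lookup (tuple ν) j ≡ class (ν , j)
    lookup-tuple ν j = lookup∘tabulate (λ j → class (ν , j)) j

    lookup-tuple⁻ : ∀ {ν i μ j} → lookup (tuple ν) i ≡ lookup (tuple μ) j → (ν , i) ~ (μ , j)
    lookup-tuple⁻ {ν} {i} {μ} {j} e =
      class-injective (trans (sym (lookup-tuple ν i)) (trans e (lookup-tuple μ j)))

    lookup-tuple⁺ : ∀ {ν i μ j} → (ν , i) ~ (μ , j) → lookup (tuple ν) i ≡ lookup (tuple μ) j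
    lookup-tuple⁺ {ν} {i} {μ} {j} e = trans (lookup-tuple ν i) (trans (class-cong e) (sym (lookup-tuple μ j)))

    Unit* : Pred (Vec Quotient n) 0ℓ
    Unit* s = ∃[ ν ] s ≡ tuple ν

    replacement-closed : ∀ s i j → Unit* s → Unit* (s ∘ᵥ [ i ∣ j ])
    replacement-closed s i j (ν , refl) with i Fin.≟ j
    ... | yes refl = ν , lookup-injective _ _ λ l → at l
      where
      at : ∀ l → lookup (tuple ν ∘ᵥ [ i ∣ i ]) l ≡ lookup (tuple ν) l
      at l with l Fin.≟ i
      ... | yes refl = lookup-∘replacement-≡ (tuple ν) i i
      ... | no  l≢i  = lookup-∘replacement-≢ (tuple ν) i l≢i
    ... | no i≢j = ν ∷ʳ κ , lookup-injective _ _ at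
      where
      κ : Key R n k
      κ = wit i (eq i j)
      off : ∀ l → l ≢ i → (ν , l) ~ (ν ∷ʳ κ , l)
      off l l≢i = forced-always λ ρ → sym (proj₁ (edge ρ ν κ) l l≢i)
      diagonal : (ν ∷ʳ κ , i) ~ (ν ∷ʳ κ , j)
      diagonal = forced-always λ ρ →
        let s = value ρ ν; 𝔐 = model ρ in
        proj₂ (edge ρ ν κ)
          ( s ∘ᵥ [ i ∣ j ]
          , unit-replacement k (Model.isUnit 𝔐) s i j (unit ρ ν)
          , (λ l l≢i → lookup-∘replacement-≢ s j l≢i)
          , trans (lookup-∘replacement-≡ s i j) (sym (lookup-∘replacement-≢ s j (i≢j ∘ sym))))
      at : ∀ l → lookup (tuple ν ∘ᵥ [ i ∣ j ]) l ≡ lookup (tuple (ν ∷ʳ κ)) l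
      at l with l Fin.≟ i
      ... | yes refl = trans (lookup-∘replacement-≡ (tuple ν) i j)
                         (lookup-tuple⁺ (~-trans (off j (i≢j ∘ sym)) (~-sym diagonal)))
      ... | no  l≢i  = trans (lookup-∘replacement-≢ (tuple ν) j l≢i) (lookup-tuple⁺ (off l l≢i))

    transposition-closed : k ≡ G → ∀ s i j → Unit* s → Unit* (s ∘ᵥ transposition i j)
    transposition-closed refl s i j (ν , refl) = ν ∷ʳ swap i j , lookup-injective _ _ λ l →
      trans (lookup-∘transposition (tuple ν) i j l) (lookup-tuple⁺ (forced-always λ ρ →
        sym (trans (cong (λ s → lookup s l) (edge ρ ν (swap i j))) (lookup-∘transposition (value ρ ν) i j l))))

    genericModel : Model R n k
    genericModel = record
      { Base     = Quotient
      ; V        = Unit*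
      ; isUnit   = isUnit-generated k Unit* replacement-closed transposition-closed
      ; nonempty = tuple [] , [] , refl
      ; covers   = λ q → class-covered q (class-surjective q)
      ; ⟦_⟧      = λ r s → ∃[ ν ] s ≡ tuple ν × Enforced (ν , rel r)
      ; ⟦⟧⊆V     = λ r (ν , e , _) → ν , e
      }
      where
      class-covered : ∀ q → ∃[ x ] class x ≡ q → ∃[ s ] Unit* s × q occursIn s
      class-covered q ((ν , j) , refl) = tuple ν , (ν , refl) , ∈-tabulate⁺ (λ j → class (ν , j)) j

    tuple-≡ : ∀ {μ ν} → tuple μ ≡ tuple ν → Forced λ ρ → value ρ μ ≡ value ρ ν
    tuple-≡ {μ} {ν} e = forced-map (λ ρ → lookup-injective _ _)
      (forced-∀ λ j → lookup-tuple⁻ {μ} {j} {ν} {j} (cong (λ s → lookup s j) e))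

    tuple-∘ᵥ-≡ : ∀ {ν μ} τ → tuple ν ∘ᵥ τ ≡ tuple μ → Forced λ ρ → value ρ ν ∘ᵥ τ ≡ value ρ μ
    tuple-∘ᵥ-≡ {ν} {μ} τ e = forced-map
      (λ ρ p → lookup-injective _ _ λ j → trans (lookup-∘ᵥ (value ρ ν) τ j) (p j))
      (forced-∀ λ j → lookup-tuple⁻ {ν} {lookup τ j} {μ} {j}
        (trans (sym (lookup-∘ᵥ (tuple ν) τ j)) (cong (λ s → lookup s j) e)))

    truth⁺ : ∀ φ {ν} → Forced (_⊩ (ν , φ)) → Sat genericModel (tuple ν) φ
    truth⁻ : ∀ φ {ν} → Sat genericModel (tuple ν) φ → Forced (_⊩ (ν , φ))

    truth⁺ (rel r) {ν} p = ν , refl , forced⇒enforced p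
    truth⁺ (relAt r τ) {ν} p =
      let μ , e = Model.isUnit genericModel (tuple ν) (ν , refl) τ
      in μ , e , forced⇒enforced (forced-map₂ (λ ρ → subst (Model.⟦_⟧ (model ρ) r)) (tuple-∘ᵥ-≡ τ e) p)
    truth⁺ (eq i j) p = lookup-tuple⁺ p
    truth⁺ ⊥′ p = ¬forced-⊥ p
    truth⁺ (φ ∧′ ψ) p = truth⁺ φ (forced-map (λ _ → proj₁) p) , truth⁺ ψ (forced-map (λ _ → proj₂) p)
    truth⁺ (φ ∨′ ψ) {ν} p with forced? ν φ
    ... | inj₁ q  = inj₁ (truth⁺ φ q)
    ... | inj₂ ¬q = inj₂ (truth⁺ ψ (forced-map₂ (λ _ p ¬q → [ ⊥-elim ∘ ¬q , id ]′ p) p ¬q))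
    truth⁺ (φ ⇒′ ψ) p q = truth⁺ ψ (forced-map₂ (λ _ p q → p q) p (truth⁻ φ q))
    truth⁺ (∃′ i φ) {ν} p =
      tuple (ν ∷ʳ wit i φ) , (ν ∷ʳ wit i φ , refl) ,
      (λ j j≢i → lookup-tuple⁺ (forced-always λ ρ → proj₁ (edge ρ ν (wit i φ)) j j≢i)) ,
      truth⁺ φ (forced-map (λ ρ → proj₂ (edge ρ ν (wit i φ))) p)

    truth⁻ (rel r) {ν} (μ , e , r∈) =
      forced-map₂ (λ ρ → subst (Model.⟦_⟧ (model ρ) r)) (tuple-≡ (sym e)) (enforced⇒forced r∈)
    truth⁻ (relAt r τ) {ν} (μ , e , r∈) =
      forced-map₂ (λ ρ e → subst (Model.⟦_⟧ (model ρ) r) (sym e)) (tuple-∘ᵥ-≡ τ e) (enforced⇒forced r∈)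
    truth⁻ (eq i j) e = lookup-tuple⁻ e
    truth⁻ (φ ∧′ ψ) (p , q) = forced-map₂ (λ _ → _,_) (truth⁻ φ p) (truth⁻ ψ q)
    truth⁻ (φ ∨′ ψ) (inj₁ p) = forced-map (λ _ → inj₁) (truth⁻ φ p)
    truth⁻ (φ ∨′ ψ) (inj₂ q) = forced-map (λ _ → inj₂) (truth⁻ ψ q)
    truth⁻ (φ ⇒′ ψ) {ν} p with forced? ν φ
    ... | inj₁ q  = forced-map (λ _ r _ → r) (truth⁻ ψ (p (truth⁺ φ q)))
    ... | inj₂ ¬q = forced-map (λ _ ¬q q → ⊥-elim (¬q q)) ¬q
    truth⁻ (∃′ i φ) {ν} (_ , (μ , refl) , t≈s , p) =
      forced-map₂ (λ ρ agree q → value ρ μ , unit ρ μ , agree , q) (forced-∀ agree) (truth⁻ φ p)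
      where
      agree : ∀ j → Forced λ ρ → j ≢ i → lookup (value ρ μ) j ≡ lookup (value ρ ν) j
      agree j with j Fin.≟ i
      ... | yes j≡i = forced-always λ _ j≢i → contradiction j≡i j≢i
      ... | no  j≢i = forced-map (λ _ e _ → e) (lookup-tuple⁻ {μ} {j} {ν} {j} (t≈s j j≢i))

    genericModel-countable : Countable Quotient
    genericModel-countable = Quotient-countable

    genericModel-models : IsModelOf genericModel T
    genericModel-models φ φ∈ _ (ν , refl) =
      truth⁺ φ (forced-always λ ρ → models ρ φ φ∈ (value ρ ν) (unit ρ ν))

    genericModel-omits : ∀ i → Omits genericModel (Γ i)
    genericModel-omits i (_ , (ν , refl) , p) =
      let m , γ , γ∈ , ¬γ∈ = omits i ν
      in truth⁺ (¬′ γ) (enforced⇒forced (m , ¬γ∈)) (p γ γ∈)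

  OmittingModel : ∀ {R n k} → Pred (Formula R n k) 0ℓ → {I : Set} → (I → Pred (Formula R n k) 0ℓ) → Set₁
  OmittingModel {R} {n} {k} T Γ =
    Σ[ 𝔐 ∈ Model R n k ] Countable (Model.Base 𝔐) × IsModelOf 𝔐 T × (∀ i → Omits 𝔐 (Γ i))

  module _ {R : Set} (code : Countable R) {n : ℕ} {k : Kind}
           (T : Pred (Formula R (suc n) k) 0ℓ) (con : Consistent T) where

    omittingTypes⁺ : ∀ {I} → I → Guessable I →
                     (Γ : I → Pred (Formula R (suc n) k) 0ℓ) → (∀ i → NonPrincipal T (Γ i)) →
                     OmittingModel T Γ
    omittingTypes⁺ i₀ guessable Γ nonprincipal =
      genericModel , genericModel-countable , genericModel-models , genericModel-omits
      where
      ℕ↠K : ℕ ↠ Key R (suc n) k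
      ℕ↠K = ℕ↠Key code (ℕ↠Fin n) k
      open GenericModel T (Omission.genericChain T ℕ↠K (ℕ↠Formula code (ℕ↠Fin n) k)
                          con i₀ guessable Γ nonprincipal)
          ℕ↠K (ℕ↠Fin n)

    omittingTypes : ∀ {I} → Guessable I →
                    (Γ : I → Pred (Formula R (suc n) k) 0ℓ) → (∀ i → NonPrincipal T (Γ i)) →
                    OmittingModel T Γ
    omittingTypes {I} guessable Γ nonprincipal with decide I
    ... | yes i₀ = omittingTypes⁺ i₀ guessable Γ nonprincipal
    ... | no  ¬I =
      let 𝔐 , countable , ⊨T , _ = omittingTypes⁺ tt (countable⇒guessable (mk↣ {to = λ _ → 0} λ _ → refl))
            (λ _ φ → φ ≡ ⊥′) (λ { _ (ψ , ψ-con , ⊨) → ψ-con (⊨ ⊥′ refl) })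
      in 𝔐 , countable , ⊨T , ⊥-elim ∘ ¬I

theorem5p33 : (∀ ℓ → ExcludedMiddle ℓ) →
    (n : ℕ) → 1 < n → (k : Kind) →
    HasOmittingTypesTheorem n k ×
    ((K : Set) → IsCovK K →
    (R : Set) → Countable R →
    (T : Pred (Formula R n k) 0ℓ) → Consistent T →
    (I : Set) → I ≺ K →
    (Γ : I → Pred (Formula R n k) 0ℓ) → (∀ i → NonPrincipal T (Γ i)) →
    Σ[ 𝔐 ∈ Model R n k ]
    Countable (Model.Base 𝔐) × IsModelOf 𝔐 T × (∀ i → Omits 𝔐 (Γ i)))
theorem5p33 em (suc n) _ k =
  (λ R code T con I I-countable Γ nonprincipal →
    let 𝔐 , _ , ⊨T , omits = omittingTypes code T con (countable⇒guessable I-countable) Γ nonprincipal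
    in 𝔐 , ⊨T , omits) ,
  (λ K (_ , least) R code T con I (_ , K↣̸I) Γ nonprincipal →
    omittingTypes code T con (¬covers⇒guessable (K↣̸I ∘ least I)) Γ nonprincipal)
  where
  open Classical em
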